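{- For every index theory $T_I$, the theories $\mathcal{CARD}(T_I)$ and $\mathcal{CARDC}(T_I)$ both enjoy the amalgamation property: for $T$ either of these theories, whenever $\mathcal M_1,\mathcal M_2$ are models of $T$ and $\mathcal A$ is a common submodel of them, there exist a model $\mathcal M$ of $T$ and embeddings $\mu_1:\mathcal M_1\to\mathcal M$, $\mu_2:\mathcal M_2\to\mathcal M$ whose restrictions to $|\mathcal A|$ coincide.
   Context: All theories are (many-sorted) first-order theories with equality. $|\mathcal M|$ is the support of a structure $\mathcal M$. An embedding is an injective (sort-preserving) map preserving and reflecting the interpretation of all function and relation symbols. Index theory. An index theory $T_I$ is a mono-sorted theory (its sort is called INDEX) such that: (a) $T_I$ is universal (all axioms are universal sentences), stably infinite (every $T_I$-satisfiable quantifier-free formula is satisfiable in an infinite model of $T_I$) and has the strong amalgamation property: for all models $\mathcal M_1,\mathcal M_2$ of $T_I$ with a common submodel $\mathcal A$ there are a model $\mathcal M$ of $T_I$ and embeddings $\mu_i:\mathcal M_i\to \mathcal M$ agreeing on $|\mathcal A|$ and such that $\mu_1(m_1)=\mu_2(m_2)$ implies $m_1=a=m_2$ for some $a\in|\mathcal A|$ (equivalently, general quantifier-free interpolation); (b) $T_I$-satisfiability of quantifier-free formulae is decidable; (c) $T_I$ extends the theory of linear (total) orders $\le$ with a distinguished constant $0$. We write $i<j$ for $i\le j\wedge i\ne j$; $\max$ is assumed to be a symbol of $T_I$ (it is definable). The theory $\mathcal{CARD}(T_I)$. Sorts: ARRAY, ELEM, INDEX. Symbols: those of $T_I$ (on INDEX);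 $rd:\mathrm{ARRAY}\times\mathrm{INDEX}\to\mathrm{ELEM}$; $wr:\mathrm{ARRAY}\times\mathrm{INDEX}\times\mathrm{ELEM}\to\mathrm{ARRAY}$; $\mathtt{diff}:\mathrm{ARRAY}\times\mathrm{ARRAY}\to\mathrm{INDEX}$; $|-|:\mathrm{ARRAY}\to\mathrm{INDEX}$; constants $\bot, el$ of sort ELEM. Axioms: the axioms of $T_I$ and the universal closures of: 1. $|wr(y,i,e)|=|y|$; 2. $wr(y,i,\bot)=y$; 3. $(e\ne\bot\wedge 0\le i\le|y|)\to rd(wr(y,i,e),i)=e$; 4. $i\ne j\to rd(wr(y,i,e),j)=rd(y,j)$; 5. $rd(y,i)\ne\bot\leftrightarrow 0\le i\le|y|$; 6. $|y|\ge 0$; 7. $\mathtt{diff}(y,y)=0$; 8. $x\ne y\to rd(x,\mathtt{diff}(x,y))\ne rd(y,\mathtt{diff}(x,y))$; 9. $\mathtt{diff}(x,y)<i\to rd(x,i)=rd(y,i)$; 10. $\bot\ne el$. The theory $\mathcal{CARDC}(T_I)$ extends $\mathcal{CARD}(T_I)$ with a function symbol $\mathtt{Const}:\mathrm{INDEX}\to\mathrm{ARRAY}$ and the axioms (universally closed): $|\mathtt{Const}(i)|=\max(i,0)$; and $(0\le j\wedge j\le|\mathtt{Const}(i)|)\to rd(\mathtt{Const}(i),j)=el$. -}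

module Defs where

open import Data.Empty using (⊥)
open import Data.Fin using (Fin; toℕ)
open import Data.List using (List; []; _∷_; map)
open import Data.List.Membership.Propositional using (_∈_)
open import Data.List.Membership.Propositional.Properties using (∈-map⁺)
open import Data.List.Relation.Unary.All as All using (All; []; _∷_)
open import Data.List.Relation.Unary.Any as Any using (here; there)
open import Data.Nat using (ℕ; zero; suc; _+_; _*_; _^_; _<_)
open import Data.Product using (Σ; Σ-syntax; ∃; ∃-syntax; _×_; _,_)
open import Data.Sum using (_⊎_)
open import Data.Unit using (⊤; tt)
open import Data.Vec as Vec using (Vec; []; _∷_)
open import Function.Bundles using (_⇔_; _↔_; _↣_; Injection)
open import Function.Definitions using (Injective)
open import Level using (Level; Lift) renaming (suc to lsuc)
open import Relation.Binary.PropositionalEquality using (_≡_; refl)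
open import Relation.Nullary using (¬_)

------------------------------------------------------------------------
-- Many-sorted first-order logic with equality

record Signature (Sort : Set) : Set₁ where
  field
    Fun  : Set
    dom  : Fun → List Sort
    cod  : Fun → Sort
    Rel  : Set
    rdom : Rel → List Sort

module _ {Sort : Set} (𝓢 : Signature Sort) where
  open Signature 𝓢

  -- The free variables of terms and formulas are the positions of the
  -- list Γ (de Bruijn indices); the head of Γ is the variable bound last.

  data Term (Γ : List Sort) : Sort → Set where
    var : ∀ {s} → s ∈ Γ → Term Γ s
    app : (f : Fun) → All (Term Γ) (dom f) → Term Γ (cod f)

  infix  7 _≐_
  infixr 6 _∧′_
  infixr 5 _∨′_
  infixr 4 _⇒′_

  data Formula (Γ : List Sort) : Set where
    ⊥′   : Formula Γ
    _≐_  : ∀ {s} → Term Γ s → Term Γ s → Formula Γ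
    rel  : (r : Rel) → All (Term Γ) (rdom r) → Formula Γ
    _∧′_ : Formula Γ → Formula Γ → Formula Γ
    _∨′_ : Formula Γ → Formula Γ → Formula Γ
    _⇒′_ : Formula Γ → Formula Γ → Formula Γ
    ∀′   : (s : Sort) → Formula (s ∷ Γ) → Formula Γ
    ∃′   : (s : Sort) → Formula (s ∷ Γ) → Formula Γ

  Sentence : Set
  Sentence = Formula []

  record Theory : Set₁ where
    field
      Axiom : Set
      axiom : Axiom → Sentence

  record Structure (ℓ : Level) : Set (lsuc ℓ) where
    field
      Carrier : Sort → Set ℓ
      point   : ∀ s → Carrier s   -- supports are nonempty
      funI    : (f : Fun) → All Carrier (dom f) → Carrier (cod f)
      relI    : (r : Rel) → All Carrier (rdom r) → Set ℓ

module _ {Sort : Set} {𝓢 : Signature Sort} where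
  open Signature 𝓢

  infix  8 ¬′_
  infix  7 _≠_
  infixr 4 _⇔′_

  ¬′_ : ∀ {Γ} → Formula 𝓢 Γ → Formula 𝓢 Γ
  ¬′ φ = φ ⇒′ ⊥′

  _≠_ : ∀ {Γ s} → Term 𝓢 Γ s → Term 𝓢 Γ s → Formula 𝓢 Γ
  t ≠ u = ¬′ (t ≐ u)

  _⇔′_ : ∀ {Γ} → Formula 𝓢 Γ → Formula 𝓢 Γ → Formula 𝓢 Γ
  φ ⇔′ ψ = (φ ⇒′ ψ) ∧′ (ψ ⇒′ φ)

  v₀ : ∀ {Γ s} → Term 𝓢 (s ∷ Γ) s
  v₀ = var (here refl)

  v₁ : ∀ {Γ s s′} → Term 𝓢 (s′ ∷ s ∷ Γ) s
  v₁ = var (there (here refl))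

  v₂ : ∀ {Γ s s′ s″} → Term 𝓢 (s″ ∷ s′ ∷ s ∷ Γ) s
  v₂ = var (there (there (here refl)))

  v₃ : ∀ {Γ s s′ s″ s‴} → Term 𝓢 (s‴ ∷ s″ ∷ s′ ∷ s ∷ Γ) s
  v₃ = var (there (there (there (here refl))))

  close : ∀ Γ → Formula 𝓢 Γ → Sentence 𝓢
  close []      φ = φ
  close (s ∷ Γ) φ = close Γ (∀′ s φ)

  data QuantifierFree {Γ : List Sort} : Formula 𝓢 Γ → Set where
    ⊥′   : QuantifierFree ⊥′
    _≐_  : ∀ {s} (t u : Term 𝓢 Γ s) → QuantifierFree (t ≐ u)
    rel  : ∀ r (ts : All (Term 𝓢 Γ) (rdom r)) → QuantifierFree (rel r ts)
    _∧′_ : ∀ {φ ψ} → QuantifierFree φ → QuantifierFree ψ → QuantifierFree (φ ∧′ ψ)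
    _∨′_ : ∀ {φ ψ} → QuantifierFree φ → QuantifierFree ψ → QuantifierFree (φ ∨′ ψ)
    _⇒′_ : ∀ {φ ψ} → QuantifierFree φ → QuantifierFree ψ → QuantifierFree (φ ⇒′ ψ)

  UniversalSentence : Sentence 𝓢 → Set
  UniversalSentence σ =
    Σ[ Γ ∈ List Sort ] Σ[ φ ∈ Formula 𝓢 Γ ] QuantifierFree φ × σ ≡ close Γ φ

  Universal : Theory 𝓢 → Set
  Universal T = ∀ a → UniversalSentence (axiom a) where open Theory T

  module _ {ℓ : Level} (𝓜 : Structure 𝓢 ℓ) where
    open Structure 𝓜

    mutual
      ⟦_⟧ : ∀ {Γ s} → Term 𝓢 Γ s → All Carrier Γ → Carrier s
      ⟦ var x ⟧    ρ = All.lookup ρ x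
      ⟦ app f ts ⟧ ρ = funI f (⟦ ts ⟧* ρ)

      ⟦_⟧* : ∀ {Γ ss} → All (Term 𝓢 Γ) ss → All Carrier Γ → All Carrier ss
      ⟦ [] ⟧*     ρ = []
      ⟦ t ∷ ts ⟧* ρ = ⟦ t ⟧ ρ ∷ ⟦ ts ⟧* ρ

    Holds : ∀ {Γ} → Formula 𝓢 Γ → All Carrier Γ → Set ℓ
    Holds ⊥′         ρ = Lift ℓ ⊥
    Holds (t ≐ u)    ρ = ⟦ t ⟧ ρ ≡ ⟦ u ⟧ ρ
    Holds (rel r ts) ρ = relI r (⟦ ts ⟧* ρ)
    Holds (φ ∧′ ψ)   ρ = Holds φ ρ × Holds ψ ρ
    Holds (φ ∨′ ψ)   ρ = Holds φ ρ ⊎ Holds ψ ρ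
    Holds (φ ⇒′ ψ)   ρ = Holds φ ρ → Holds ψ ρ
    Holds (∀′ s φ)   ρ = ∀ x → Holds φ (x ∷ ρ)
    Holds (∃′ s φ)   ρ = ∃[ x ] Holds φ (x ∷ ρ)

  record Model (ℓ : Level) (T : Theory 𝓢) : Set (lsuc ℓ) where
    open Theory T
    field
      structure : Structure 𝓢 ℓ
      satisfies : ∀ a → Holds structure (axiom a) []
    open Structure structure public

  record Embedding {ℓ : Level} (𝓜 𝓝 : Structure 𝓢 ℓ) : Set ℓ where
    private
      module M = Structure 𝓜
      module N = Structure 𝓝
    field
      fn        : ∀ {s} → M.Carrier s → N.Carrier s
      injective : ∀ {s} → Injective _≡_ _≡_ (fn {s})
      fun-homo  : ∀ f xs → fn (M.funI f xs) ≡ N.funI f (All.map fn xs)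
      rel-homo  : ∀ r xs → M.relI r xs ⇔ N.relI r (All.map fn xs)

  module _ (ℓ : Level) (T : Theory 𝓢) where
    private
      _↪_ : Model ℓ T → Model ℓ T → Set ℓ
      M ↪ N = Embedding (Model.structure M) (Model.structure N)

    open Embedding

    Entails : Sentence 𝓢 → Set (lsuc ℓ)
    Entails φ = (M : Model ℓ T) → Holds (Model.structure M) φ []

    Satisfiable : ∀ {Γ} → Formula 𝓢 Γ → Set (lsuc ℓ)
    Satisfiable {Γ} φ =
      Σ[ M ∈ Model ℓ T ] Σ[ ρ ∈ All (Model.Carrier M) Γ ]
        Holds (Model.structure M) φ ρ

    -- A common submodel of M₁ and M₂ is a model together with embeddings
    -- ι₁ and ι₂ into them, which play the role of the set inclusions.

    Amalgamation : Set (lsuc ℓ)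
    Amalgamation =
      (M₁ M₂ A : Model ℓ T) (ι₁ : A ↪ M₁) (ι₂ : A ↪ M₂) →
      Σ[ M ∈ Model ℓ T ] Σ[ μ₁ ∈ M₁ ↪ M ] Σ[ μ₂ ∈ M₂ ↪ M ]
        (∀ {s} (a : Model.Carrier A s) → fn μ₁ (fn ι₁ a) ≡ fn μ₂ (fn ι₂ a))

    StrongAmalgamation : Set (lsuc ℓ)
    StrongAmalgamation =
      (M₁ M₂ A : Model ℓ T) (ι₁ : A ↪ M₁) (ι₂ : A ↪ M₂) →
      Σ[ M ∈ Model ℓ T ] Σ[ μ₁ ∈ M₁ ↪ M ] Σ[ μ₂ ∈ M₂ ↪ M ]
        (∀ {s} (a : Model.Carrier A s) → fn μ₁ (fn ι₁ a) ≡ fn μ₂ (fn ι₂ a)) ×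
        (∀ {s} (m₁ : Model.Carrier M₁ s) (m₂ : Model.Carrier M₂ s) →
           fn μ₁ m₁ ≡ fn μ₂ m₂ →
           Σ[ a ∈ Model.Carrier A s ] m₁ ≡ fn ι₁ a × fn ι₂ a ≡ m₂)

Infinite : ∀ {a} → Set a → Set a
Infinite A = ¬ (∃[ n ] (A ↔ Fin n))

StablyInfinite : ∀ {𝓢 : Signature ⊤} (ℓ : Level) → Theory 𝓢 → Set (lsuc ℓ)
StablyInfinite {𝓢} ℓ T =
  ∀ {Γ} (φ : Formula 𝓢 Γ) → QuantifierFree φ → Satisfiable ℓ T φ →
  Σ[ M ∈ Model ℓ T ] Infinite (Model.Carrier M tt) ×
    (Σ[ ρ ∈ All (Model.Carrier M) Γ ] Holds (Model.structure M) φ ρ)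

------------------------------------------------------------------------
-- Decidability of satisfiability
--
-- With excluded middle available, `Dec` does not express algorithmic
-- decidability.  It is expressed here by μ-recursive functions acting on
-- Gödel numbers.

data Rec : ℕ → Set where
  zer  : ∀ {n} → Rec n
  succ : Rec 1
  proj : ∀ {n} → Fin n → Rec n
  comp : ∀ {m n} → Rec m → Vec (Rec n) m → Rec n
  prim : ∀ {n} → Rec n → Rec (2 + n) → Rec (suc n)
  mini : ∀ {n} → Rec (suc n) → Rec n

data _[_]⇓_ : ∀ {n} → Rec n → Vec ℕ n → ℕ → Set where
  zer  : ∀ {n} {xs : Vec ℕ n} → zer [ xs ]⇓ 0
  succ : ∀ {x} → succ [ x ∷ [] ]⇓ suc x
  proj : ∀ {n} {xs : Vec ℕ n} {i} → proj i [ xs ]⇓ Vec.lookup xs i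
  comp : ∀ {m n} {f : Rec m} {gs : Vec (Rec n) m} {xs ys z} →
         (∀ i → Vec.lookup gs i [ xs ]⇓ Vec.lookup ys i) →
         f [ ys ]⇓ z → comp f gs [ xs ]⇓ z
  prim-zero : ∀ {n} {f : Rec n} {g xs z} →
              f [ xs ]⇓ z → prim f g [ 0 ∷ xs ]⇓ z
  prim-suc  : ∀ {n} {f : Rec n} {g xs k y z} →
              prim f g [ k ∷ xs ]⇓ y → g [ k ∷ y ∷ xs ]⇓ z →
              prim f g [ suc k ∷ xs ]⇓ z
  mini : ∀ {n} {f : Rec (suc n)} {xs k} →
         f [ k ∷ xs ]⇓ 0 →
         (∀ j → j < k → ∃[ y ] f [ j ∷ xs ]⇓ suc y) →
         mini f [ xs ]⇓ k

-- An injective pairing function; its values are positive.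
⟨_,_⟩ : ℕ → ℕ → ℕ
⟨ a , b ⟩ = 2 ^ a * (1 + 2 * b)

record Coding {Sort : Set} (𝓢 : Signature Sort) : Set where
  open Signature 𝓢
  field
    codeFun : Fun ↣ ℕ
    codeRel : Rel ↣ ℕ

module _ {𝓢 : Signature ⊤} (c : Coding 𝓢) where
  open Coding c
  open Injection using (to)

  mutual
    codeTerm : ∀ {Γ s} → Term 𝓢 Γ s → ℕ
    codeTerm (var x)    = ⟨ 0 , toℕ (Any.index x) ⟩
    codeTerm (app f ts) = ⟨ suc (to codeFun f) , codeTerms ts ⟩

    codeTerms : ∀ {Γ ss} → All (Term 𝓢 Γ) ss → ℕ
    codeTerms []       = 0
    codeTerms (t ∷ ts) = ⟨ codeTerm t , codeTerms ts ⟩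

  code : ∀ {Γ} → Formula 𝓢 Γ → ℕ
  code ⊥′         = ⟨ 0 , 0 ⟩
  code (t ≐ u)    = ⟨ 1 , ⟨ codeTerm t , codeTerm u ⟩ ⟩
  code (rel r ts) = ⟨ 2 , ⟨ to codeRel r , codeTerms ts ⟩ ⟩
  code (φ ∧′ ψ)   = ⟨ 3 , ⟨ code φ , code ψ ⟩ ⟩
  code (φ ∨′ ψ)   = ⟨ 4 , ⟨ code φ , code ψ ⟩ ⟩
  code (φ ⇒′ ψ)   = ⟨ 5 , ⟨ code φ , code ψ ⟩ ⟩
  code (∀′ s φ)   = ⟨ 6 , code φ ⟩
  code (∃′ s φ)   = ⟨ 7 , code φ ⟩

DecidableQFSatisfiability :
  ∀ {𝓢 : Signature ⊤} (ℓ : Level) → Coding 𝓢 → Theory 𝓢 → Set (lsuc ℓ)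
DecidableQFSatisfiability {𝓢} ℓ c T =
  Σ[ d ∈ Rec 1 ] (∀ {Γ} (φ : Formula 𝓢 Γ) → QuantifierFree φ →
    (Satisfiable ℓ T φ → d [ code c φ ∷ [] ]⇓ 1) ×
    (¬ Satisfiable ℓ T φ → d [ code c φ ∷ [] ]⇓ 0))

------------------------------------------------------------------------
-- Index theories

data OrderFun (F : Set) : Set where
  zero max : OrderFun F
  other    : F → OrderFun F

data OrderRel (R : Set) : Set where
  le    : OrderRel R
  other : R → OrderRel R

-- The signature of an index theory: 0, max, ≤ and arbitrary further symbols.
IndexSignature : Signature ⊤ → Signature ⊤
IndexSignature 𝓔 = record
  { Fun  = OrderFun E.Fun
  ; dom  = λ { zero → [] ; max → tt ∷ tt ∷ [] ; (other f) → E.dom f }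
  ; cod  = λ _ → tt
  ; Rel  = OrderRel E.Rel
  ; rdom = λ { le → tt ∷ tt ∷ [] ; (other r) → E.rdom r }
  }
  where module E = Signature 𝓔

module OrderAxioms (𝓔 : Signature ⊤) where
  private
    𝓘 = IndexSignature 𝓔

    infix 7 _≤′_
    _≤′_ : ∀ {Γ} → Term 𝓘 Γ tt → Term 𝓘 Γ tt → Formula 𝓘 Γ
    i ≤′ j = rel le (i ∷ j ∷ [])

    max′ : ∀ {Γ} → Term 𝓘 Γ tt → Term 𝓘 Γ tt → Term 𝓘 Γ tt
    max′ i j = app max (i ∷ j ∷ [])

  reflexive transitive antisymmetric total max-spec : Sentence 𝓘
  reflexive     = close (tt ∷ []) (v₀ ≤′ v₀)
  transitive    = close (tt ∷ tt ∷ tt ∷ []) (v₀ ≤′ v₁ ∧′ v₁ ≤′ v₂ ⇒′ v₀ ≤′ v₂)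
  antisymmetric = close (tt ∷ tt ∷ []) (v₀ ≤′ v₁ ∧′ v₁ ≤′ v₀ ⇒′ v₀ ≐ v₁)
  total         = close (tt ∷ tt ∷ []) (v₀ ≤′ v₁ ∨′ v₁ ≤′ v₀)
  max-spec      = close (tt ∷ tt ∷ [])
                    ((v₀ ≤′ v₁ ⇒′ max′ v₀ v₁ ≐ v₁) ∧′
                     (v₁ ≤′ v₀ ⇒′ max′ v₀ v₁ ≐ v₀))

record IndexTheory (ℓ : Level) : Set (lsuc ℓ) where
  field
    extra  : Signature ⊤
    theory : Theory (IndexSignature extra)
  open OrderAxioms extra
  field
    universal          : Universal theory
    stablyInfinite     : StablyInfinite ℓ theory
    strongAmalgamation : StrongAmalgamation ℓ theory
    coding             : Coding (IndexSignature extra)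
    decidable          : DecidableQFSatisfiability ℓ coding theory
    ≤-reflexive        : Entails ℓ theory reflexive
    ≤-transitive       : Entails ℓ theory transitive
    ≤-antisymmetric    : Entails ℓ theory antisymmetric
    ≤-total            : Entails ℓ theory total
    max-is-maximum     : Entails ℓ theory max-spec

------------------------------------------------------------------------
-- The theories CARD and CARDC

data ArraySort : Set where
  ARRAY ELEM INDEX : ArraySort

-- The language without and with the symbol Const.
data Language : Set where
  card cardc : Language

data ArrayFun (F : Set) : Language → Set where
  idx            : ∀ {L} → F → ArrayFun F L
  rd wr diff len : ∀ {L} → ArrayFun F L
  bot el         : ∀ {L} → ArrayFun F L
  Const          : ArrayFun F cardc

ArraySignature : Signature ⊤ → Language → Signature ArraySort
ArraySignature 𝓘 L = record
  { Fun  = ArrayFun I.Fun L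
  ; dom  = λ { (idx f) → map (λ _ → INDEX) (I.dom f)
             ; rd      → ARRAY ∷ INDEX ∷ []
             ; wr      → ARRAY ∷ INDEX ∷ ELEM ∷ []
             ; diff    → ARRAY ∷ ARRAY ∷ []
             ; len     → ARRAY ∷ []
             ; bot     → []
             ; el      → []
             ; Const   → INDEX ∷ [] }
  ; cod  = λ { (idx _) → INDEX
             ; rd      → ELEM
             ; wr      → ARRAY
             ; diff    → INDEX
             ; len     → INDEX
             ; bot     → ELEM
             ; el      → ELEM
             ; Const   → ARRAY }
  ; Rel  = I.Rel
  ; rdom = λ r → map (λ _ → INDEX) (I.rdom r)
  }
  where module I = Signature 𝓘

module _ {𝓘 : Signature ⊤} (L : Language) where
  private
    𝓐 = ArraySignature 𝓘 L

    ix : List ⊤ → List ArraySort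
    ix = map (λ _ → INDEX)

  mutual
    liftTerm : ∀ {Γ s} → Term 𝓘 Γ s → Term 𝓐 (ix Γ) INDEX
    liftTerm (var x)    = var (∈-map⁺ (λ _ → INDEX) x)
    liftTerm (app f ts) = app (idx f) (liftTerms ts)

    liftTerms : ∀ {Γ ss} → All (Term 𝓘 Γ) ss → All (Term 𝓐 (ix Γ)) (ix ss)
    liftTerms []       = []
    liftTerms (t ∷ ts) = liftTerm t ∷ liftTerms ts

  liftFormula : ∀ {Γ} → Formula 𝓘 Γ → Formula 𝓐 (ix Γ)
  liftFormula ⊥′         = ⊥′
  liftFormula (t ≐ u)    = liftTerm t ≐ liftTerm u
  liftFormula (rel r ts) = rel r (liftTerms ts)
  liftFormula (φ ∧′ ψ)   = liftFormula φ ∧′ liftFormula ψ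
  liftFormula (φ ∨′ ψ)   = liftFormula φ ∨′ liftFormula ψ
  liftFormula (φ ⇒′ ψ)   = liftFormula φ ⇒′ liftFormula ψ
  liftFormula (∀′ s φ)   = ∀′ INDEX (liftFormula φ)
  liftFormula (∃′ s φ)   = ∃′ INDEX (liftFormula φ)

data ArrayAxiom (Ax : Set) : Language → Set where
  index-axiom : ∀ {L} → Ax → ArrayAxiom Ax L
  len-wr wr-bot rd-wr-same rd-wr-other rd-defined : ∀ {L} → ArrayAxiom Ax L
  len-nonneg diff-same diff-differs diff-max bot≠el : ∀ {L} → ArrayAxiom Ax L
  len-Const rd-Const : ArrayAxiom Ax cardc

module ArrayTheory {ℓ : Level} (T : IndexTheory ℓ) where
  open IndexTheory T using (extra; theory)
  open Theory theory

  𝓘 : Signature ⊤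
  𝓘 = IndexSignature extra

  private
    module Syntax {L : Language} {Γ : List ArraySort} where
      Tm : ArraySort → Set
      Tm = Term (ArraySignature 𝓘 L) Γ

      Fm : Set
      Fm = Formula (ArraySignature 𝓘 L) Γ

      Rd : Tm ARRAY → Tm INDEX → Tm ELEM
      Rd y i = app rd (y ∷ i ∷ [])

      Wr : Tm ARRAY → Tm INDEX → Tm ELEM → Tm ARRAY
      Wr y i e = app wr (y ∷ i ∷ e ∷ [])

      Diff : Tm ARRAY → Tm ARRAY → Tm INDEX
      Diff x y = app diff (x ∷ y ∷ [])

      ∣_∣ : Tm ARRAY → Tm INDEX
      ∣ y ∣ = app len (y ∷ [])

      Bot El : Tm ELEM
      Bot = app bot []
      El  = app el []

      O : Tm INDEX
      O = app (idx zero) []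

      Max : Tm INDEX → Tm INDEX → Tm INDEX
      Max i j = app (idx max) (i ∷ j ∷ [])

      infix 7 _≤′_ _<′_
      _≤′_ _<′_ : Tm INDEX → Tm INDEX → Fm
      i ≤′ j = rel le (i ∷ j ∷ [])
      i <′ j = i ≤′ j ∧′ i ≠ j

    open Syntax

    CONST : ∀ {Γ} → Term (ArraySignature 𝓘 cardc) Γ INDEX →
            Term (ArraySignature 𝓘 cardc) Γ ARRAY
    CONST i = app Const (i ∷ [])

  arrayAxiom : ∀ {L} → ArrayAxiom Axiom L → Sentence (ArraySignature 𝓘 L)
  arrayAxiom {L} (index-axiom a) = liftFormula L (axiom a)
  arrayAxiom len-wr = close (ELEM ∷ INDEX ∷ ARRAY ∷ [])
    (let e = v₀; i = v₁; y = v₂ in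
     ∣ Wr y i e ∣ ≐ ∣ y ∣)
  arrayAxiom wr-bot = close (INDEX ∷ ARRAY ∷ [])
    (let i = v₀; y = v₁ in
     Wr y i Bot ≐ y)
  arrayAxiom rd-wr-same = close (ELEM ∷ INDEX ∷ ARRAY ∷ [])
    (let e = v₀; i = v₁; y = v₂ in
     e ≠ Bot ∧′ O ≤′ i ∧′ i ≤′ ∣ y ∣ ⇒′ Rd (Wr y i e) i ≐ e)
  arrayAxiom rd-wr-other = close (ELEM ∷ INDEX ∷ INDEX ∷ ARRAY ∷ [])
    (let e = v₀; j = v₁; i = v₂; y = v₃ in
     i ≠ j ⇒′ Rd (Wr y i e) j ≐ Rd y j)
  arrayAxiom rd-defined = close (INDEX ∷ ARRAY ∷ [])
    (let i = v₀; y = v₁ in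
     Rd y i ≠ Bot ⇔′ O ≤′ i ∧′ i ≤′ ∣ y ∣)
  arrayAxiom len-nonneg = close (ARRAY ∷ [])
    (let y = v₀ in
     O ≤′ ∣ y ∣)
  arrayAxiom diff-same = close (ARRAY ∷ [])
    (let y = v₀ in
     Diff y y ≐ O)
  arrayAxiom diff-differs = close (ARRAY ∷ ARRAY ∷ [])
    (let y = v₀; x = v₁ in
     x ≠ y ⇒′ Rd x (Diff x y) ≠ Rd y (Diff x y))
  arrayAxiom diff-max = close (INDEX ∷ ARRAY ∷ ARRAY ∷ [])
    (let i = v₀; y = v₁; x = v₂ in
     Diff x y <′ i ⇒′ Rd x i ≐ Rd y i)
  arrayAxiom bot≠el = Bot ≠ El
  arrayAxiom len-Const = close (INDEX ∷ [])
    (let i = v₀ in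
     ∣ CONST i ∣ ≐ Max i O)
  arrayAxiom rd-Const = close (INDEX ∷ INDEX ∷ [])
    (let j = v₀; i = v₁ in
     O ≤′ j ∧′ j ≤′ ∣ CONST i ∣ ⇒′ Rd (CONST i) j ≐ El)

  arrayTheory : (L : Language) → Theory (ArraySignature 𝓘 L)
  arrayTheory L = record { Axiom = ArrayAxiom Axiom L ; axiom = arrayAxiom }

CARD : ∀ {ℓ} (T : IndexTheory ℓ) →
       Theory (ArraySignature (IndexSignature (IndexTheory.extra T)) card)
CARD T = ArrayTheory.arrayTheory T card

CARDC : ∀ {ℓ} (T : IndexTheory ℓ) →
        Theory (ArraySignature (IndexSignature (IndexTheory.extra T)) cardc)
CARDC T = ArrayTheory.arrayTheory T cardc

{-# OPTIONS --safe #-}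

-- By extensionality an array is its function of reads.  Two arrays must differ
-- at a largest index, and since arrays are closed under finite modification,
-- this must remain so when finitely many indices are discarded.
--
-- The indices are amalgamated strongly.  An array x of M₁ is extended to an
-- index k outside M₁ as follows: if some array c of the base has the length of
-- x and agrees with x, up to finitely many exceptions, above some j < k, then
-- the value of c is used.  Inside a model this preserves diff.  Arrays x of M₁
-- and y of M₂ with a common length may still fail to have a largest
-- difference, but only if their differences accumulate at the cut below which
-- x (or y) no longer agrees with an array of the base.  All intervals around
-- that cut are infinite, so by compactness the index model has an extension
-- with a descending sequence inside the cut, and there x gets a value that
-- occurs in no array of M₂.  Compactness is obtained from an ultrapower: the
-- theory of indices is universal, and excluded middle, being stated for all
-- types, provides a choice operator.

module Submission where

open import Defs
open import Level using (Level)
open import Data.Product using (_×_)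
open import Axiom.ExcludedMiddle using (ExcludedMiddle)
open import Axiom.Extensionality.Propositional using (Extensionality)
open import Data.Bool as Bool using (Bool; true; false; T)
open import Data.Bool.Properties using (T-irrelevant)
open import Data.Empty using (⊥-elim)
open import Data.List using (List; []; _∷_; _++_; map; applyUpTo)
open import Data.List.Membership.Propositional using (_∈_; _∉_)
open import Data.List.Membership.Propositional.Properties using (∈-++⁺ˡ; ∈-++⁺ʳ; ∈-++⁻; ∈-map⁺; ∈-applyUpTo⁺)
open import Data.List.Relation.Binary.Subset.Propositional using (_⊆_)
open import Data.List.Relation.Unary.All as All using (All; []; _∷_)
open import Data.List.Relation.Unary.All.Properties using (++⁺; ++⁻ˡ; ++⁻ʳ; lookup-map; map⁺; map⁻; map-∘)
open import Data.List.Relation.Unary.Any using (here; there)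
open import Data.Maybe using (Maybe; just; nothing)
open import Data.Nat as ℕ using (ℕ; zero; suc)
import Data.Nat.Properties as ℕ
open import Data.Product using (Σ-syntax; ∃-syntax; _,_; proj₁; proj₂)
open import Data.Sum using (_⊎_; inj₁; inj₂; [_,_]′)
open import Data.Sum.Properties using (inj₁-injective)
open import Data.Unit using (⊤; tt)
open import Function.Base using (_∘_; id)
open import Function.Bundles using (_⇔_; mk⇔; Equivalence)
open import Function.Definitions using (Injective)
open import Level using (Lift; lift; lower) renaming (suc to lsuc)
open import Relation.Binary.Definitions using (tri<; tri≈; tri>)
open import Relation.Binary.PropositionalEquality using (_≡_; _≢_; refl; sym; trans; cong; cong₂; subst; subst₂)
open import Relation.Nullary using (¬_; Dec; yes; no; contradiction)
open import Relation.Nullary.Decidable using (isYes; toWitness; fromWitness; decidable-stable)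

-- A single new point in the cut would not do: a write can make the two arrays equal there, and the
-- differences below would again have no largest one. A descending sequence keeps a largest term
-- after any finite deletion, namely its earliest remaining one. The filling must not disturb `Diff`
-- inside one model either, so the new points are attached to the cut alone: arrays of one model
-- that agree, up to finitely many exceptions, above some index below the cut have the same cut,
-- hence the same fresh values.
--
-- The cuts are defined by comparing arrays over the final index model, which must already contain
-- the sequences. This circle is broken by assigning a sequence in advance to every set of indices
-- of the two models; only for actual cuts are its terms known to descend and to lie in the cut.
--
-- All this concerns arrays of equal length, since otherwise the end of the longer array is the
-- largest difference. By strong amalgamation a length common to both sides belongs to the base, so
-- fresh values can be confined to such lengths.

private
  variable
    a b c ℓ : Level

-- Choice, quotients and ultrafilters from excluded middle

module Classical (em : ∀ {a} → ExcludedMiddle a) (funext : ∀ {a b} → Extensionality a b) where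

  -- Excluded middle resizes every type to a truth value; this is what makes
  -- families of subsets available without raising the universe level.
  ⌊_⌋ : Set a → Bool
  ⌊ P ⌋ = isYes (em {P = P})

  ⌊⌋⁺ : {P : Set a} → P → T ⌊ P ⌋
  ⌊⌋⁺ = fromWitness

  ⌊⌋⁻ : {P : Set a} → T ⌊ P ⌋ → P
  ⌊⌋⁻ = toWitness

  T-ext : {x y : Bool} → (T x → T y) → (T y → T x) → x ≡ y
  T-ext {false} {false} f g = refl
  T-ext {false} {true}  f g = ⊥-elim (g _)
  T-ext {true}  {false} f g = ⊥-elim (f _)
  T-ext {true}  {true}  f g = refl

  ⌊⌋-cong : {P : Set a} {Q : Set b} → (P → Q) → (Q → P) → ⌊ P ⌋ ≡ ⌊ Q ⌋
  ⌊⌋-cong f g = T-ext (λ p → ⌊⌋⁺ (f (⌊⌋⁻ p))) (λ q → ⌊⌋⁺ (g (⌊⌋⁻ q)))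

  stable : {P : Set a} → ¬ ¬ P → P
  stable = decidable-stable em

  ¬∀⇒∃ : {A : Set a} {P : A → Set b} → ¬ (∀ x → ¬ P x) → ∃[ x ] P x
  ¬∀⇒∃ ¬∀ = stable λ ¬∃ → ¬∀ λ x p → ¬∃ (x , p)

  module Quotient {X : Set a} (_∼_ : X → X → Set b)
    (∼-refl : ∀ {x} → x ∼ x) (∼-sym : ∀ {x y} → x ∼ y → y ∼ x)
    (∼-trans : ∀ {x y z} → x ∼ y → y ∼ z → x ∼ z) where

    private
      class : X → X → Bool
      class x y = ⌊ x ∼ y ⌋

      -- Equal predicates make `em` return the same witness, so this is a choice operator on
      -- classes; the second argument is a default for the empty predicate.
      pick : (X → Bool) → X → X
      pick P x with em {P = ∃[ y ] T (P y)}
      ... | yes (y , _) = y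
      ... | no  _       = x

      pick-∈ : ∀ (P : X → Bool) x → T (P x) → T (P (pick P x))
      pick-∈ P x p with em {P = ∃[ y ] T (P y)}
      ... | yes (y , q) = q
      ... | no  ¬q      = contradiction (x , p) ¬q

      pick-default : ∀ (P : X → Bool) x y → T (P x) → pick P x ≡ pick P y
      pick-default P x y p with em {P = ∃[ y ] T (P y)}
      ... | yes _ = refl
      ... | no ¬q = contradiction (x , p) ¬q

      rep : X → X
      rep x = pick (class x) x

      rep-∼ : ∀ x → rep x ∼ x
      rep-∼ x = ∼-sym (⌊⌋⁻ (pick-∈ (class x) x (⌊⌋⁺ ∼-refl)))

      rep-cong : ∀ {x y} → x ∼ y → rep x ≡ rep y
      rep-cong {x} {y} x∼y = trans
        (cong (λ P → pick P x) (funext λ z →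
          ⌊⌋-cong (∼-trans (∼-sym x∼y)) (∼-trans x∼y)))
        (pick-default (class y) x y (⌊⌋⁺ (∼-sym x∼y)))

    Quot : Set a
    Quot = Σ[ x ∈ X ] T ⌊ rep x ≡ x ⌋

    [_] : X → Quot
    [ x ] = rep x , ⌊⌋⁺ (rep-cong (rep-∼ x))

    out : Quot → X
    out = proj₁

    out-[] : ∀ x → out [ x ] ∼ x
    out-[] = rep-∼

    out-injective : ∀ {p q} → out p ≡ out q → p ≡ q
    out-injective {x , p} {_ , q} refl = cong (x ,_) (T-irrelevant p q)

    out-∼ : ∀ {p q} → out p ∼ out q → p ≡ q
    out-∼ {p} {q} p∼q = out-injective
      (trans (sym (⌊⌋⁻ (proj₂ p))) (trans (rep-cong p∼q) (⌊⌋⁻ (proj₂ q))))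

  -- The ultrafilter is a maximal family of subsets all of whose finite
  -- intersections meet every cone of a directed preorder.  It is the top of a
  -- Bourbaki–Witt tower, which is a chain by a double induction.

  module Ultrafilter {S : Set ℓ} (_⊑_ : S → S → Set ℓ)
    (⊑-refl : ∀ {s} → s ⊑ s) (⊑-trans : ∀ {s t u} → s ⊑ t → t ⊑ u → s ⊑ u)
    (directed : ∀ s t → ∃[ u ] s ⊑ u × t ⊑ u) (s₀ : S) where

    private
      Subset Family : Set ℓ
      Subset = S → Bool
      Family = Subset → Bool

      infix 4 _⊆ᶠ_ _∈ᶠ_ _∈*_
      _∈ᶠ_ : Subset → Family → Set
      B ∈ᶠ 𝓖 = T (𝓖 B)

      _⊆ᶠ_ : Family → Family → Set ℓ
      𝓖 ⊆ᶠ 𝓗 = ∀ B → B ∈ᶠ 𝓖 → B ∈ᶠ 𝓗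

      _∈*_ : S → List Subset → Set ℓ
      s ∈* L = All (λ B → T (B s)) L

      FIP : Family → Set ℓ
      FIP 𝓖 = ∀ L → All (_∈ᶠ 𝓖) L → ∀ σ → ∃[ s ] σ ⊑ s × s ∈* L

      _∪_ : Family → Subset → Family
      (𝓖 ∪ B) C = ⌊ C ∈ᶠ 𝓖 ⊎ C ≡ B ⌋

      Extendable : Family → Set ℓ
      Extendable 𝓖 = ∃[ B ] ¬ B ∈ᶠ 𝓖 × FIP (𝓖 ∪ B)

      next : Family → Family
      next 𝓖 with em {P = Extendable 𝓖}
      ... | yes (B , _) = 𝓖 ∪ B
      ... | no  _       = 𝓖

      next-⊇ : ∀ 𝓖 → 𝓖 ⊆ᶠ next 𝓖
      next-⊇ 𝓖 C C∈ with em {P = Extendable 𝓖}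
      ... | yes _ = ⌊⌋⁺ (inj₁ C∈)
      ... | no  _ = C∈

      next-FIP : ∀ 𝓖 → FIP 𝓖 → FIP (next 𝓖)
      next-FIP 𝓖 fip with em {P = Extendable 𝓖}
      ... | yes (_ , _ , fip′) = fip′
      ... | no  _              = fip

      next-fixed : ∀ 𝓖 → next 𝓖 ⊆ᶠ 𝓖 → ¬ Extendable 𝓖
      next-fixed 𝓖 sub with em {P = Extendable 𝓖}
      ... | yes (B , B∉ , _) = λ _ → B∉ (sub B (⌊⌋⁺ (inj₂ refl)))
      ... | no  ¬ext         = ¬ext

      ⋃ : (Family → Bool) → Family
      ⋃ 𝓒 B = ⌊ (∃[ 𝓖 ] T (𝓒 𝓖) × B ∈ᶠ 𝓖) ⌋

      data Tower : Family → Set ℓ where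
        step  : ∀ {𝓖} → Tower 𝓖 → Tower (next 𝓖)
        union : ∀ 𝓒 → (∀ 𝓖 → T (𝓒 𝓖) → Tower 𝓖) → Tower (⋃ 𝓒)

      ⊆-refl : ∀ {𝓖} → 𝓖 ⊆ᶠ 𝓖
      ⊆-refl B B∈ = B∈

      ⊆-antisym : ∀ {𝓖 𝓗} → 𝓖 ⊆ᶠ 𝓗 → 𝓗 ⊆ᶠ 𝓖 → 𝓖 ≡ 𝓗
      ⊆-antisym f g = funext λ B → T-ext (f B) (g B)

      ⋃-least : ∀ 𝓒 {𝓗} → (∀ 𝓖 → T (𝓒 𝓖) → 𝓖 ⊆ᶠ 𝓗) → ⋃ 𝓒 ⊆ᶠ 𝓗
      ⋃-least 𝓒 f B B∈ with ⌊⌋⁻ B∈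
      ... | 𝓖 , 𝓖∈ , B∈𝓖 = f 𝓖 𝓖∈ B B∈𝓖

      ⋃-upper : ∀ 𝓒 {𝓖} → T (𝓒 𝓖) → 𝓖 ⊆ᶠ ⋃ 𝓒
      ⋃-upper 𝓒 {𝓖} 𝓖∈ B B∈ = ⌊⌋⁺ (𝓖 , 𝓖∈ , B∈)

      ⋃-split : ∀ 𝓒 {𝓗 𝓗′} → (∀ 𝓖 → T (𝓒 𝓖) → 𝓖 ⊆ᶠ 𝓗 ⊎ 𝓗′ ⊆ᶠ 𝓖) → ⋃ 𝓒 ⊆ᶠ 𝓗 ⊎ 𝓗′ ⊆ᶠ ⋃ 𝓒
      ⋃-split 𝓒 {𝓗} {𝓗′} f with em {P = ∃[ 𝓖 ] T (𝓒 𝓖) × 𝓗′ ⊆ᶠ 𝓖}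
      ... | yes (𝓖 , 𝓖∈ , sub) = inj₂ λ B B∈ → ⋃-upper 𝓒 𝓖∈ B (sub B B∈)
      ... | no ¬∃ = inj₁ (⋃-least 𝓒 below)
        where
        below : ∀ 𝓖 → T (𝓒 𝓖) → 𝓖 ⊆ᶠ 𝓗
        below 𝓖 𝓖∈ with f 𝓖 𝓖∈
        ... | inj₁ sub = sub
        ... | inj₂ sub = contradiction (𝓖 , 𝓖∈ , sub) ¬∃

      -- The one case of `step` not settled by the hypotheses is that `𝓖` and `𝓗` contain each
      -- other; then they are equal and have the same successor.
      no-gap : ∀ {𝓖 𝓗} → (∀ {𝓗} → Tower 𝓗 → 𝓖 ⊆ᶠ 𝓗 ⊎ next 𝓗 ⊆ᶠ 𝓖) →
               Tower 𝓗 → 𝓗 ⊆ᶠ 𝓖 ⊎ next 𝓖 ⊆ᶠ 𝓗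
      no-gap cmp (union 𝓒 t) = ⋃-split 𝓒 λ 𝓗 𝓗∈ → no-gap cmp (t 𝓗 𝓗∈)
      no-gap {𝓖} cmp (step {𝓗} t) with cmp t
      ... | inj₂ sub = inj₁ sub
      ... | inj₁ 𝓖⊆𝓗 with no-gap cmp t
      ...   | inj₂ sub = inj₂ λ B B∈ → next-⊇ 𝓗 B (sub B B∈)
      ...   | inj₁ 𝓗⊆𝓖 = inj₂ (subst (λ 𝓚 → next 𝓖 ⊆ᶠ next 𝓚) (⊆-antisym 𝓖⊆𝓗 𝓗⊆𝓖) ⊆-refl)

      -- The second alternative is stronger than mere inclusion because the `step` case of `no-gap`
      -- consumes it in this form.
      comparable : ∀ {𝓖} → Tower 𝓖 → ∀ {𝓗} → Tower 𝓗 → 𝓖 ⊆ᶠ 𝓗 ⊎ next 𝓗 ⊆ᶠ 𝓖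
      comparable (union 𝓒 t) u = ⋃-split 𝓒 λ 𝓖 𝓖∈ → comparable (t 𝓖 𝓖∈) u
      comparable (step {𝓖} t) {𝓗} u with no-gap (comparable t) u
      ... | inj₂ sub = inj₁ sub
      ... | inj₁ 𝓗⊆𝓖 with comparable t u
      ...   | inj₂ sub = inj₂ λ B B∈ → next-⊇ 𝓖 B (sub B B∈)
      ...   | inj₁ 𝓖⊆𝓗 = inj₂ (subst (λ 𝓚 → next 𝓗 ⊆ᶠ next 𝓚) (⊆-antisym 𝓗⊆𝓖 𝓖⊆𝓗) ⊆-refl)

      chain : ∀ {𝓖 𝓗} → Tower 𝓖 → Tower 𝓗 → 𝓖 ⊆ᶠ 𝓗 ⊎ 𝓗 ⊆ᶠ 𝓖
      chain t u with comparable t u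
      ... | inj₁ sub = inj₁ sub
      ... | inj₂ sub = inj₂ λ B B∈ → sub B (next-⊇ _ B B∈)

      common : ∀ 𝓒 → (∀ 𝓖 → T (𝓒 𝓖) → Tower 𝓖) → ∀ B L → All (_∈ᶠ ⋃ 𝓒) (B ∷ L) →
               ∃[ 𝓖 ] T (𝓒 𝓖) × All (_∈ᶠ 𝓖) (B ∷ L)
      common 𝓒 t B [] (B∈ ∷ []) with ⌊⌋⁻ B∈
      ... | 𝓖 , 𝓖∈ , B∈𝓖 = 𝓖 , 𝓖∈ , B∈𝓖 ∷ []
      common 𝓒 t B (C ∷ L) (B∈ ∷ L∈) with ⌊⌋⁻ B∈ | common 𝓒 t C L L∈
      ... | 𝓖 , 𝓖∈ , B∈𝓖 | 𝓗 , 𝓗∈ , L∈𝓗 with chain (t 𝓖 𝓖∈) (t 𝓗 𝓗∈)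
      ...   | inj₁ sub = 𝓗 , 𝓗∈ , sub B B∈𝓖 ∷ L∈𝓗
      ...   | inj₂ sub = 𝓖 , 𝓖∈ , B∈𝓖 ∷ All.map (λ {C} → sub C) L∈𝓗

      tower-FIP : ∀ {𝓖} → Tower 𝓖 → FIP 𝓖
      tower-FIP (step {𝓖} t) = next-FIP 𝓖 (tower-FIP t)
      tower-FIP (union 𝓒 t) [] [] σ = σ , ⊑-refl , []
      tower-FIP (union 𝓒 t) (B ∷ L) L∈ σ with common 𝓒 t B L L∈
      ... | 𝓖 , 𝓖∈ , L∈𝓖 = tower-FIP (t 𝓖 𝓖∈) (B ∷ L) L∈𝓖 σ

      𝓤 : Family
      𝓤 = ⋃ λ 𝓖 → ⌊ Tower 𝓖 ⌋

      𝓤-tower : Tower 𝓤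
      𝓤-tower = union _ λ 𝓖 → ⌊⌋⁻

      𝓤-FIP : FIP 𝓤
      𝓤-FIP = tower-FIP 𝓤-tower

      𝓤-maximal : ∀ B → FIP (𝓤 ∪ B) → B ∈ᶠ 𝓤
      𝓤-maximal B fip = stable λ B∉ →
        next-fixed 𝓤 (⋃-upper _ (⌊⌋⁺ (step 𝓤-tower))) (B , B∉ , fip)

      strip : ∀ {B} L → All (_∈ᶠ 𝓤 ∪ B) L →
              ∃[ L′ ] All (_∈ᶠ 𝓤) L′ × (∀ s → T (B s) → s ∈* L′ → s ∈* L)
      strip [] [] = [] , [] , λ _ _ _ → []
      strip (C ∷ L) (C∈ ∷ L∈) with ⌊⌋⁻ C∈ | strip L L∈
      ... | inj₁ C∈𝓤 | L′ , L′∈ , f = C ∷ L′ , C∈𝓤 ∷ L′∈ , λ { s b (c ∷ l) → c ∷ f s b l }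
      ... | inj₂ refl | L′ , L′∈ , f = L′ , L′∈ , λ s b l → b ∷ f s b l

      -- Adjoining `B` keeps the intersection property: beyond a common bound of the two cones,
      -- every point of the members in `L` lies in `B`. Maximality does the rest, and the closure
      -- laws of `Most` are instances.
      𝓤-absorbs : ∀ B L → All (_∈ᶠ 𝓤) L → ∀ σ → (∀ s → σ ⊑ s → s ∈* L → T (B s)) → B ∈ᶠ 𝓤
      𝓤-absorbs B L L∈ σ f = 𝓤-maximal B fip
        where
        fip : FIP (𝓤 ∪ B)
        fip L₁ L₁∈ σ₁ with strip L₁ L₁∈ | directed σ σ₁
        ... | L′ , L′∈ , g | τ , σ⊑τ , σ₁⊑τ with 𝓤-FIP (L ++ L′) (++⁺ L∈ L′∈) τ
        ... | s , τ⊑s , s∈ = s , ⊑-trans σ₁⊑τ τ⊑s ,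
              g s (f s (⊑-trans σ⊑τ τ⊑s) (++⁻ˡ L s∈)) (++⁻ʳ L s∈)

      ⌊_⌋ˢ : (S → Set a) → Subset
      ⌊ P ⌋ˢ s = ⌊ P s ⌋

    abstract
      Most : (S → Set a) → Set
      Most P = ⌊ P ⌋ˢ ∈ᶠ 𝓤

      most-cone : {P : S → Set a} → ∀ σ → (∀ s → σ ⊑ s → P s) → Most P
      most-cone σ f = 𝓤-absorbs _ [] [] σ λ s σ⊑s _ → ⌊⌋⁺ (f s σ⊑s)

      most-map : {P : S → Set a} {Q : S → Set b} → (∀ s → P s → Q s) → Most P → Most Q
      most-map {P = P} f p = 𝓤-absorbs _ (⌊ P ⌋ˢ ∷ []) (p ∷ []) s₀
        λ { s _ (ps ∷ []) → ⌊⌋⁺ (f s (⌊⌋⁻ ps)) }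

      most-zip : {P : S → Set a} {Q : S → Set b} {R : S → Set c} →
                 (∀ s → P s → Q s → R s) → Most P → Most Q → Most R
      most-zip {P = P} {Q} f p q = 𝓤-absorbs _ (⌊ P ⌋ˢ ∷ ⌊ Q ⌋ˢ ∷ []) (p ∷ q ∷ []) s₀
        λ { s _ (ps ∷ qs ∷ []) → ⌊⌋⁺ (f s (⌊⌋⁻ ps) (⌊⌋⁻ qs)) }

      most-all : {P : S → Set a} → (∀ s → P s) → Most P
      most-all f = most-cone s₀ λ s _ → f s

      most-∃ : {P : S → Set a} → Most P → ∃[ s ] P s
      most-∃ {P = P} p with 𝓤-FIP (⌊ P ⌋ˢ ∷ []) (p ∷ []) s₀
      ... | s , _ , ps ∷ [] = s , ⌊⌋⁻ ps

      -- If `P` cannot be adjoined to `𝓤`, finitely many members have no common point in `P` beyond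
      -- some `σ`; these members and that cone force the complement.
      most-¬ : {P : S → Set a} → ¬ Most P → Most (λ s → ¬ P s)
      most-¬ {P = P} ¬p = stable λ ¬q → ¬p (𝓤-maximal _ λ L L∈ σ → stable λ none → ¬q (lemma L L∈ σ none))
        where
        lemma : ∀ L → All (_∈ᶠ 𝓤 ∪ ⌊ P ⌋ˢ) L → ∀ σ → ¬ (∃[ s ] σ ⊑ s × s ∈* L) → Most (λ s → ¬ P s)
        lemma L L∈ σ none with strip L L∈
        ... | L′ , L′∈ , f = 𝓤-absorbs _ L′ L′∈ σ λ s σ⊑s s∈ →
              ⌊⌋⁺ λ p → none (s , σ⊑s , f s (⌊⌋⁺ p) s∈)

-- Ultrapowers and universal sentences

module Universals {Sort : Set} {𝓢 : Signature Sort} {ℓ} (𝓜 : Structure 𝓢 ℓ) where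
  open Structure 𝓜

  close⁻ : ∀ Γ {φ : Formula 𝓢 Γ} → Holds 𝓜 (close Γ φ) [] → ∀ ρ → Holds 𝓜 φ ρ
  close⁻ []      h []      = h
  close⁻ (s ∷ Γ) h (x ∷ ρ) = close⁻ Γ h ρ x

  close⁺ : ∀ Γ {φ : Formula 𝓢 Γ} → (∀ ρ → Holds 𝓜 φ ρ) → Holds 𝓜 (close Γ φ) []
  close⁺ []      h = h []
  close⁺ (s ∷ Γ) h = close⁺ Γ λ ρ x → h (x ∷ ρ)

module UltrapowerOf (em : ∀ {a} → ExcludedMiddle a) (funext : ∀ {a b} → Extensionality a b)
  {ℓ} {S : Set ℓ} (_⊑_ : S → S → Set ℓ)
  (⊑-refl : ∀ {s} → s ⊑ s) (⊑-trans : ∀ {s t u} → s ⊑ t → t ⊑ u → s ⊑ u)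
  (directed : ∀ s t → ∃[ u ] s ⊑ u × t ⊑ u) (s₀ : S)
  {Sort : Set} {𝓢 : Signature Sort} (𝓜 : Structure 𝓢 ℓ) where

  open Classical em funext
  open Ultrafilter _⊑_ ⊑-refl ⊑-trans directed s₀ public
  open Signature 𝓢
  open Structure 𝓜

  private
    module Q (s : Sort) = Quotient {X = S → Carrier s} (λ f g → Most (λ i → f i ≡ g i))
      (most-all λ _ → refl) (most-map λ _ → sym) (most-zip λ _ → trans)

  Carrier* : Sort → Set ℓ
  Carrier* = Q.Quot

  [_] : ∀ {s} → (S → Carrier s) → Carrier* s
  [ f ] = Q.[_] _ f

  at : S → ∀ {s} → Carrier* s → Carrier s
  at i x = Q.out _ x i

  at-[] : ∀ {s} (f : S → Carrier s) → Most (λ i → at i [ f ] ≡ f i)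
  at-[] = Q.out-[] _

  at-injective : ∀ {s} {x y : Carrier* s} → Most (λ i → at i x ≡ at i y) → x ≡ y
  at-injective = Q.out-∼ _

  ultrapower : Structure 𝓢 ℓ
  ultrapower = record
    { Carrier = Carrier*
    ; point   = λ s → [ (λ _ → point s) ]
    ; funI    = λ f xs → [ (λ i → funI f (All.map (at i) xs)) ]
    ; relI    = λ r xs → Lift ℓ (Most λ i → relI r (All.map (at i) xs))
    }

  mutual
    at-⟦⟧ : ∀ {Γ s} (t : Term 𝓢 Γ s) ρ →
            Most (λ i → at i (⟦_⟧ ultrapower t ρ) ≡ ⟦_⟧ 𝓜 t (All.map (at i) ρ))
    at-⟦⟧ (var x)    ρ = most-all λ i → sym (lookup-map ρ x)
    at-⟦⟧ (app f ts) ρ = most-zip (λ i p q → trans p (cong (funI f) q)) (at-[] _) (at-⟦⟧* ts ρ)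

    at-⟦⟧* : ∀ {Γ ss} (ts : All (Term 𝓢 Γ) ss) ρ →
             Most (λ i → All.map (at i) (⟦_⟧* ultrapower ts ρ) ≡ ⟦_⟧* 𝓜 ts (All.map (at i) ρ))
    at-⟦⟧* []       ρ = most-all λ i → refl
    at-⟦⟧* (t ∷ ts) ρ = most-zip (λ i → cong₂ _∷_) (at-⟦⟧ t ρ) (at-⟦⟧* ts ρ)

  mutual
    -- Quantifier-free formulas suffice for universal axioms. Premises of implications reverse the
    -- direction, hence the mutual induction.
    łoś⁺ : ∀ {Γ} {φ : Formula 𝓢 Γ} → QuantifierFree φ → ∀ ρ →
           Holds ultrapower φ ρ → Most (λ i → Holds 𝓜 φ (All.map (at i) ρ))
    łoś⁺ ⊥′ ρ h = ⊥-elim (lower h)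
    łoś⁺ (t ≐ u) ρ h = most-zip (λ i p q → trans (sym p) (trans (cong (at i) h) q))
      (at-⟦⟧ t ρ) (at-⟦⟧ u ρ)
    łoś⁺ (rel r ts) ρ h = most-zip (λ i → subst (relI r)) (at-⟦⟧* ts ρ) (lower h)
    łoś⁺ (p ∧′ q) ρ (h , k) = most-zip (λ _ → _,_) (łoś⁺ p ρ h) (łoś⁺ q ρ k)
    łoś⁺ (p ∨′ q) ρ (inj₁ h) = most-map (λ _ → inj₁) (łoś⁺ p ρ h)
    łoś⁺ (p ∨′ q) ρ (inj₂ h) = most-map (λ _ → inj₂) (łoś⁺ q ρ h)
    łoś⁺ (_⇒′_ {φ} p q) ρ h with em {P = Most λ i → Holds 𝓜 φ (All.map (at i) ρ)}
    ... | yes m = most-map (λ _ k _ → k) (łoś⁺ q ρ (h (łoś⁻ p ρ m)))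
    ... | no ¬m = most-map (λ _ ¬k k → contradiction k ¬k) (most-¬ ¬m)

    łoś⁻ : ∀ {Γ} {φ : Formula 𝓢 Γ} → QuantifierFree φ → ∀ ρ →
           Most (λ i → Holds 𝓜 φ (All.map (at i) ρ)) → Holds ultrapower φ ρ
    łoś⁻ ⊥′ ρ m = lift (lower (proj₂ (most-∃ m)))
    łoś⁻ (t ≐ u) ρ m = at-injective (most-zip (λ i p q → trans p (sym q))
      (most-zip (λ i → trans) (at-⟦⟧ t ρ) m) (at-⟦⟧ u ρ))
    łoś⁻ (rel r ts) ρ m = lift (most-zip (λ i p → subst (relI r) (sym p)) (at-⟦⟧* ts ρ) m)
    łoś⁻ (p ∧′ q) ρ m = łoś⁻ p ρ (most-map (λ _ → proj₁) m) , łoś⁻ q ρ (most-map (λ _ → proj₂) m)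
    łoś⁻ (_∨′_ {φ} p q) ρ m with em {P = Most λ i → Holds 𝓜 φ (All.map (at i) ρ)}
    ... | yes l = inj₁ (łoś⁻ p ρ l)
    ... | no ¬l = inj₂ (łoś⁻ q ρ (most-zip
          (λ { _ (inj₁ h) ¬h → contradiction h ¬h ; _ (inj₂ h) _ → h }) m (most-¬ ¬l)))
    łoś⁻ (p ⇒′ q) ρ m h = łoś⁻ q ρ (most-zip (λ _ f → f) m (łoś⁺ p ρ h))

  ultrapower-⊨ : ∀ {σ} → UniversalSentence σ → Holds 𝓜 σ [] → Holds ultrapower σ []
  ultrapower-⊨ (Γ , φ , qf , refl) h = Universals.close⁺ ultrapower Γ λ ρ →
    łoś⁻ qf ρ (most-all λ i → Universals.close⁻ 𝓜 Γ h _)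

  diagonal : Embedding 𝓜 ultrapower
  diagonal = record
    { fn        = const*
    ; injective = λ {_} {x} {y} eq → proj₂ (most-∃ (most-zip (λ _ p q → trans (sym p) q)
                    (at-[] (λ _ → x)) (subst (λ z → Most λ i → at i z ≡ y) (sym eq) (at-[] (λ _ → y)))))
    ; fun-homo  = λ f xs → at-injective (most-zip (λ _ p q → trans p (sym q))
                    (at-[] _) (most-zip (λ i p q → trans p (cong (funI f) q)) (at-[] _) (map-at xs)))
    ; rel-homo  = λ r xs → mk⇔
                    (λ h → lift (most-map (λ i eq → subst (relI r) (sym eq) h) (map-at xs)))
                    (λ h → proj₂ (most-∃ (most-zip (λ i → subst (relI r)) (map-at xs) (lower h))))
    }
    where
    const* : ∀ {s} → Carrier s → Carrier* s
    const* x = [ (λ _ → x) ]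

    map-at : ∀ {ss} (xs : All Carrier ss) → Most (λ i → All.map (at i) (All.map const* xs) ≡ xs)
    map-at []       = most-all λ i → refl
    map-at (x ∷ xs) = most-zip (λ i → cong₂ _∷_) (at-[] (λ _ → x)) (map-at xs)

-- Linear orders of indices

module IndexOrder {ℓ} (T_I : IndexTheory ℓ) (N : Model ℓ (IndexTheory.theory T_I)) where
  open IndexTheory T_I
  open Model N

  I : Set ℓ
  I = Carrier tt

  infix 4 _≤_ _<_
  _≤_ _<_ : I → I → Set ℓ
  i ≤ j = relI le (i ∷ j ∷ [])
  i < j = i ≤ j × i ≢ j

  zeroᴵ : I
  zeroᴵ = funI zero []

  maxᴵ : I → I → I
  maxᴵ i j = funI max (i ∷ j ∷ [])

  ≤-refl : ∀ {i} → i ≤ i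
  ≤-refl {i} = ≤-reflexive N i

  ≤-trans : ∀ {i j k} → i ≤ j → j ≤ k → i ≤ k
  ≤-trans {i} {j} {k} p q = ≤-transitive N k j i (p , q)

  ≤-antisym : ∀ {i j} → i ≤ j → j ≤ i → i ≡ j
  ≤-antisym {i} {j} p q = ≤-antisymmetric N j i (p , q)

  total : ∀ i j → i ≤ j ⊎ j ≤ i
  total i j = ≤-total N j i

  max-≤ : ∀ {i j} → i ≤ j → maxᴵ i j ≡ j
  max-≤ {i} {j} = proj₁ (max-is-maximum N j i)

  max-≥ : ∀ {i j} → j ≤ i → maxᴵ i j ≡ i
  max-≥ {i} {j} = proj₂ (max-is-maximum N j i)

  <-irrefl : ∀ {i} → ¬ i < i
  <-irrefl (_ , i≢i) = i≢i refl

  <-≤-trans : ∀ {i j k} → i < j → j ≤ k → i < k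
  <-≤-trans (p , i≢j) q = ≤-trans p q , λ { refl → i≢j (≤-antisym p q) }

  ≤-<-trans : ∀ {i j k} → i ≤ j → j < k → i < k
  ≤-<-trans p (q , j≢k) = ≤-trans p q , λ { refl → j≢k (≤-antisym q p) }

  <-trans : ∀ {i j k} → i < j → j < k → i < k
  <-trans p q = <-≤-trans p (proj₁ q)

  <⇒≱ : ∀ {i j} → i < j → ¬ j ≤ i
  <⇒≱ p q = <-irrefl (<-≤-trans p q)

  module _ (em : ∀ {a} → ExcludedMiddle a) where

    ≤-or-> : ∀ i j → i ≤ j ⊎ j < i
    ≤-or-> i j with em {P = i ≡ j} | total i j
    ... | yes refl | _      = inj₁ ≤-refl
    ... | no i≢j   | inj₁ p = inj₁ p
    ... | no i≢j   | inj₂ p = inj₂ (p , i≢j ∘ sym)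

    ≰⇒> : ∀ {i j} → ¬ i ≤ j → j < i
    ≰⇒> {i} {j} i≰j with ≤-or-> i j
    ... | inj₁ p = contradiction p i≰j
    ... | inj₂ p = p

    ≮⇒≥ : ∀ {i j} → ¬ i < j → j ≤ i
    ≮⇒≥ {i} {j} i≮j with ≤-or-> j i
    ... | inj₁ p = p
    ... | inj₂ p = contradiction p i≮j

    -- One pass over `L` moves `d` up to each larger element satisfying `P`; an element that is
    -- passed over cannot qualify later, as the candidate only grows. Finite sets of exceptions are
    -- discharged this way below.
    finite-max : (P : I → Set a) (L : List I) → ∀ d → P d → (∀ k → d < k → P k → k ∈ L) →
                 ∃[ m ] P m × (∀ k → m < k → ¬ P k)
    finite-max P [] d Pd f = d , Pd , λ k d<k Pk → contradiction (f k d<k Pk) λ ()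
    finite-max P (x ∷ L) d Pd f with em {P = d < x × P x}
    ... | yes (d<x , Px) = finite-max P L x Px λ k x<k Pk → drop x<k (f k (<-trans d<x x<k) Pk)
      where
      drop : ∀ {k} → x < k → k ∈ x ∷ L → k ∈ L
      drop x<k (here refl) = contradiction x<k <-irrefl
      drop x<k (there k∈)  = k∈
    ... | no ¬x = finite-max P L d Pd λ k d<k Pk → drop d<k Pk (f k d<k Pk)
      where
      drop : ∀ {k} → d < k → P k → k ∈ x ∷ L → k ∈ L
      drop d<k Pk (here refl) = contradiction (d<k , Pk) ¬x
      drop d<k Pk (there k∈)  = k∈

    InfiniteInterval : I → I → Set ℓ
    InfiniteInterval v u = ∀ L → ∃[ x ] v < x × x < u × x ∉ L

    -- Split the interval at a point `y`. If the part below is infinite, `y` starts the chain;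
    -- otherwise the part above is infinite and `y` ends the chain. Terms from `m` on are arbitrary.
    descent : ∀ m {v u} → InfiniteInterval v u →
      Σ[ x ∈ (ℕ → I) ] (∀ n → n ℕ.< m → v < x n × x n < u) × (∀ n → suc n ℕ.< m → x (suc n) < x n)
    descent zero {v} inf = (λ _ → v) , (λ _ ()) , (λ _ ())
    descent (suc m) {v} {u} inf with inf []
    ... | y , v<y , y<u , _ with em {P = InfiniteInterval v y}
    ...   | yes inf′ with descent m inf′
    ...     | x , bounds , desc = x′ , bounds′ , desc′
      where
      x′ : ℕ → I
      x′ zero    = y
      x′ (suc n) = x n

      bounds′ : ∀ n → n ℕ.< suc m → v < x′ n × x′ n < u
      bounds′ zero    _       = v<y , y<u
      bounds′ (suc n) (ℕ.s≤s n<m) = proj₁ (bounds n n<m) , <-trans (proj₂ (bounds n n<m)) y<u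

      desc′ : ∀ n → suc n ℕ.< suc m → x′ (suc n) < x′ n
      desc′ zero    (ℕ.s≤s 0<m)   = proj₂ (bounds 0 0<m)
      desc′ (suc n) (ℕ.s≤s 1+n<m) = desc n 1+n<m
    descent (suc m) {v} {u} inf | y , v<y , y<u , _ | no ¬inf with descent m inf′
      where
      inf′ : InfiniteInterval y u
      inf′ L with em {P = ∃[ x ] y < x × x < u × x ∉ L}
      ... | yes p  = p
      ... | no ¬p = contradiction (λ L′ → below L′ (inf (y ∷ L ++ L′))) ¬inf
        where
        below : ∀ L′ → ∃[ x ] v < x × x < u × x ∉ y ∷ L ++ L′ → ∃[ x ] v < x × x < y × x ∉ L′
        below L′ (x , v<x , x<u , x∉) with ≤-or-> y x
        ... | inj₂ x<y = x , v<x , x<y , x∉ ∘ there ∘ ∈-++⁺ʳ L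
        ... | inj₁ y≤x = contradiction
              (x , (y≤x , x∉ ∘ here ∘ sym) , x<u , x∉ ∘ there ∘ ∈-++⁺ˡ) ¬p
    ... | x , bounds , desc = x′ , bounds′ , desc′
      where
      x′ : ℕ → I
      x′ n with n ℕ.<? m
      ... | yes _ = x n
      ... | no _  = y

      bounds′ : ∀ n → n ℕ.< suc m → v < x′ n × x′ n < u
      bounds′ n _ with n ℕ.<? m
      ... | yes n<m = <-trans v<y (proj₁ (bounds n n<m)) , proj₂ (bounds n n<m)
      ... | no _    = v<y , y<u

      desc′ : ∀ n → suc n ℕ.< suc m → x′ (suc n) < x′ n
      desc′ n (ℕ.s≤s n<m) with suc n ℕ.<? m | n ℕ.<? m
      ... | yes 1+n<m | yes _   = desc n 1+n<m
      ... | no _      | yes _   = proj₁ (bounds n n<m)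
      ... | _         | no n≮m  = contradiction n<m n≮m

module Monotone {ℓ} (T_I : IndexTheory ℓ) {N N′ : Model ℓ (IndexTheory.theory T_I)}
  (e : Embedding (Model.structure N) (Model.structure N′)) where
  private
    module N  = IndexOrder T_I N
    module N′ = IndexOrder T_I N′
  open Embedding e

  ≤⁺ : ∀ {i j} → i N.≤ j → fn i N′.≤ fn j
  ≤⁺ = Equivalence.to (rel-homo le _)

  ≤⁻ : ∀ {i j} → fn i N′.≤ fn j → i N.≤ j
  ≤⁻ = Equivalence.from (rel-homo le _)

  <⁻ : ∀ {i j} → fn i N′.< fn j → i N.< j
  <⁻ (p , i≢j) = ≤⁻ p , λ { refl → i≢j refl }

-- Cuts and their filling

record Cut {ℓ} (T_I : IndexTheory ℓ) (N : Model ℓ (IndexTheory.theory T_I)) {J : Set ℓ}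
  (p : J → Model.Carrier N tt) (U : J → Bool) : Set ℓ where
  open IndexOrder T_I N
  field
    upward   : ∀ {i j} → p i ≤ p j → T (U i) → T (U j)
    low      : J
    low∉     : ¬ T (U low)
    high     : J
    high∈    : T (U high)
    infinite : ∀ {v u} → ¬ T (U v) → T (U u) → (L : List I) →
               ∃[ j ] p v < p j × p j < p u × p j ∉ L

-- By compactness, all cuts of a family of points with infinite gaps are filled
-- with descending sequences in one extension: the ultrapower over the finite
-- subfamilies s and lengths m in which the n-th term is represented by the
-- n-th element of a chain of m elements within the trace of the cut on s.

module Filling (em : ∀ {a} → ExcludedMiddle a) (funext : ∀ {a b} → Extensionality a b)
  {ℓ} (T_I : IndexTheory ℓ) (N : Model ℓ (IndexTheory.theory T_I))
  {J : Set ℓ} (p : J → Model.Carrier N tt) where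

  open Classical em funext
  open IndexTheory T_I
  private
    module N = Model N
  open IndexOrder T_I N

  private
    extremum : (R : J → J → Set a) → (∀ {i j k} → R i j → R j k → R i k) → (∀ i j → R i j ⊎ R j i) →
               (Q : J → Set b) → ∀ j → Q j → (s : List J) →
               ∃[ k ] Q k × R j k × (∀ {i} → i ∈ s → Q i → R i k)
    extremum R R-trans R-total Q j Qj [] with R-total j j
    ... | inj₁ r = j , Qj , r , λ ()
    ... | inj₂ r = j , Qj , r , λ ()
    extremum R R-trans R-total Q j Qj (x ∷ s) with em {P = Q x}
    ... | no ¬Qx with extremum R R-trans R-total Q j Qj s
    ...   | k , Qk , r , f = k , Qk , r ,
            λ { (here refl) Qi → contradiction Qi ¬Qx ; (there i∈) Qi → f i∈ Qi }
    extremum R R-trans R-total Q j Qj (x ∷ s) | yes Qx with R-total j x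
    ... | inj₁ jx with extremum R R-trans R-total Q x Qx s
    ...   | k , Qk , r , f = k , Qk , R-trans jx r ,
            λ { (here refl) Qi → r ; (there i∈) Qi → f i∈ Qi }
    extremum R R-trans R-total Q j Qj (x ∷ s) | yes Qx | inj₂ xj with extremum R R-trans R-total Q j Qj s
    ...   | k , Qk , r , f = k , Qk , r ,
            λ { (here refl) Qi → R-trans xj r ; (there i∈) Qi → f i∈ Qi }

    Chain : (J → Bool) → List J → ℕ → (ℕ → I) → Set ℓ
    Chain U s m x = (∀ n → n ℕ.< m → (∀ v → v ∈ s → ¬ T (U v) → p v < x n) ×
                                     (∀ u → u ∈ s → T (U u) → x n < p u)) ×
                    (∀ n → suc n ℕ.< m → x (suc n) < x n)

    chain-exists : ∀ {U} → Cut T_I N p U → ∀ s m → ∃[ x ] Chain U s m x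
    chain-exists {U} cut s m
      -- `low` and `high` seed the two searches, since `s` may contain no point of one of the sides.
      with extremum (λ i j → p i ≤ p j) ≤-trans (λ i j → total _ _)
             (λ v → ¬ T (U v)) low low∉ s
         | extremum (λ i j → p j ≤ p i) (λ q r → ≤-trans r q) (λ i j → total _ _)
             (λ u → T (U u)) high high∈ s
      where
      open Cut cut
    ... | v , v∉ , _ , v-max | u , u∈ , _ , u-min
      with descent em m (λ L → let j , p<j , j<p , j∉ = Cut.infinite cut v∉ u∈ L in p j , p<j , j<p , j∉)
    ... | x , bounds , desc = x ,
          (λ n n<m → (λ w w∈ w∉ → ≤-<-trans (v-max w∈ w∉) (proj₁ (bounds n n<m))) ,
                     (λ w w∈ w∈U → <-≤-trans (proj₂ (bounds n n<m)) (u-min w∈ w∈U))) ,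
          desc

    pick : (J → Bool) → List J × ℕ → ℕ → I
    pick U (s , m) with em {P = ∃[ x ] Chain U s m x}
    ... | yes (x , _) = x
    ... | no _        = λ _ → N.point tt

    pick-chain : ∀ {U} → Cut T_I N p U → ∀ s m → Chain U s m (pick U (s , m))
    pick-chain {U} cut s m with em {P = ∃[ x ] Chain U s m x}
    ... | yes (_ , ch) = ch
    ... | no ¬ch       = contradiction (chain-exists cut s m) ¬ch

    _⊑_ : List J × ℕ → List J × ℕ → Set ℓ
    (s , m) ⊑ (s′ , m′) = s ⊆ s′ × m ℕ.≤ m′

  open UltrapowerOf em funext _⊑_ (id , ℕ.≤-refl)
    (λ (f , p) (g , q) → g ∘ f , ℕ.≤-trans p q)
    (λ (s , m) (s′ , m′) → (s ++ s′ , m ℕ.⊔ m′) ,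
      (∈-++⁺ˡ , ℕ.m≤m⊔n m m′) , (∈-++⁺ʳ s , ℕ.m≤n⊔m m m′))
    ([] , 0) N.structure

  extension : Model ℓ theory
  extension = record
    { structure = ultrapower
    ; satisfies = λ a → ultrapower-⊨ (universal a) (N.satisfies a)
    }

  inclusion : Embedding N.structure (Model.structure extension)
  inclusion = diagonal

  private
    module N* = IndexOrder T_I extension
    open Embedding inclusion using () renaming (fn to e)

    []-< : ∀ (f g : List J × ℕ → I) → Most (λ i → f i < g i) → [ f ] N*.< [ g ]
    []-< f g r = lift (most-map (λ _ → proj₁) lt) , λ eq → proj₂ (proj₂ (most-∃ lt)) (cong (at _) eq)
      where
      lt : Most (λ i → at i [ f ] < at i [ g ])
      lt = most-zip (λ i q → subst (_ <_) (sym q)) (at-[] g)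
             (most-zip (λ i q → subst (_< _) (sym q)) (at-[] f) r)

  -- Total in `U`, because the cuts that matter are only defined over the extension. Coordinates
  -- `(s , m)` with `m ≤ n` carry arbitrary values; the cones used below exclude them.
  gap : (J → Bool) → ℕ → Carrier* tt
  gap U n = [ (λ i → pick U i n) ]

  module _ {U : J → Bool} (cut : Cut T_I N p U) where

    gap-above : ∀ {v} → ¬ T (U v) → ∀ n → e (p v) N*.< gap U n
    gap-above {v} v∉ n = []-< _ _ (most-cone (v ∷ [] , suc n)
      λ { (s , m) (v∈s , n<m) → proj₁ (proj₁ (pick-chain cut s m) n n<m) v (v∈s (here refl)) v∉ })

    gap-below : ∀ {u} → T (U u) → ∀ n → gap U n N*.< e (p u)
    gap-below {u} u∈ n = []-< _ _ (most-cone (u ∷ [] , suc n)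
      λ { (s , m) (u∈s , n<m) → proj₂ (proj₁ (pick-chain cut s m) n n<m) u (u∈s (here refl)) u∈ })

    gap-descending : ∀ n → gap U (suc n) N*.< gap U n
    gap-descending n = []-< _ _ (most-cone ([] , suc (suc n))
      λ { (s , m) (_ , n<m) → proj₂ (pick-chain cut s m) n n<m })

-- Reducts to the index sort

infix 4 _↪_
_↪_ : ∀ {Sort : Set} {𝓢 : Signature Sort} {ℓ} {T : Theory 𝓢} → Model ℓ T → Model ℓ T → Set ℓ
M ↪ N = Embedding (Model.structure M) (Model.structure N)

module Reduct {𝓘 : Signature ⊤} {L : Language} {ℓ} (𝓜 : Structure (ArraySignature 𝓘 L) ℓ) where
  open Structure 𝓜

  reduct : Structure 𝓘 ℓ
  reduct = record
    { Carrier = λ _ → Carrier INDEX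
    ; point   = λ _ → point INDEX
    ; funI    = λ f xs → funI (idx f) (map⁺ xs)
    ; relI    = λ r xs → relI r (map⁺ xs)
    }

  private
    lookup-map⁺ : ∀ {Γ} (ρ : All {A = ⊤} (λ _ → Carrier INDEX) Γ) {s} (x : s ∈ Γ) →
                  All.lookup {P = Carrier} (map⁺ ρ) (∈-map⁺ (λ _ → INDEX) x) ≡ All.lookup ρ x
    lookup-map⁺ (y ∷ ρ) (here refl) = refl
    lookup-map⁺ (y ∷ ρ) (there x)   = lookup-map⁺ ρ x

  mutual
    lift-⟦⟧ : ∀ {Γ s} (t : Term 𝓘 Γ s) ρ → ⟦_⟧ 𝓜 (liftTerm L t) (map⁺ ρ) ≡ ⟦_⟧ reduct t ρ
    lift-⟦⟧ (var x)    ρ = lookup-map⁺ ρ x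
    lift-⟦⟧ (app f ts) ρ = cong (funI (idx f)) (lift-⟦⟧* ts ρ)

    lift-⟦⟧* : ∀ {Γ ss} (ts : All (Term 𝓘 Γ) ss) ρ →
               ⟦_⟧* 𝓜 (liftTerms L ts) (map⁺ ρ) ≡ map⁺ (⟦_⟧* reduct ts ρ)
    lift-⟦⟧* []       ρ = refl
    lift-⟦⟧* (t ∷ ts) ρ = cong₂ _∷_ (lift-⟦⟧ t ρ) (lift-⟦⟧* ts ρ)

  mutual
    lift⁺ : ∀ {Γ} (φ : Formula 𝓘 Γ) ρ → Holds reduct φ ρ → Holds 𝓜 (liftFormula L φ) (map⁺ ρ)
    lift⁺ ⊥′         ρ h = h
    lift⁺ (t ≐ u)    ρ h = trans (lift-⟦⟧ t ρ) (trans h (sym (lift-⟦⟧ u ρ)))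
    lift⁺ (rel r ts) ρ h = subst (relI r) (sym (lift-⟦⟧* ts ρ)) h
    lift⁺ (φ ∧′ ψ)   ρ (h , k) = lift⁺ φ ρ h , lift⁺ ψ ρ k
    lift⁺ (φ ∨′ ψ)   ρ (inj₁ h) = inj₁ (lift⁺ φ ρ h)
    lift⁺ (φ ∨′ ψ)   ρ (inj₂ h) = inj₂ (lift⁺ ψ ρ h)
    lift⁺ (φ ⇒′ ψ)   ρ h k = lift⁺ ψ ρ (h (lift⁻ φ ρ k))
    lift⁺ (∀′ s φ)   ρ h x = lift⁺ φ (x ∷ ρ) (h x)
    lift⁺ (∃′ s φ)   ρ (x , h) = x , lift⁺ φ (x ∷ ρ) h

    lift⁻ : ∀ {Γ} (φ : Formula 𝓘 Γ) ρ → Holds 𝓜 (liftFormula L φ) (map⁺ ρ) → Holds reduct φ ρ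
    lift⁻ ⊥′         ρ h = h
    lift⁻ (t ≐ u)    ρ h = trans (sym (lift-⟦⟧ t ρ)) (trans h (lift-⟦⟧ u ρ))
    lift⁻ (rel r ts) ρ h = subst (relI r) (lift-⟦⟧* ts ρ) h
    lift⁻ (φ ∧′ ψ)   ρ (h , k) = lift⁻ φ ρ h , lift⁻ ψ ρ k
    lift⁻ (φ ∨′ ψ)   ρ (inj₁ h) = inj₁ (lift⁻ φ ρ h)
    lift⁻ (φ ∨′ ψ)   ρ (inj₂ h) = inj₂ (lift⁻ ψ ρ h)
    lift⁻ (φ ⇒′ ψ)   ρ h k = lift⁻ ψ ρ (h (lift⁺ φ ρ k))
    lift⁻ (∀′ s φ)   ρ h x = lift⁻ φ (x ∷ ρ) (h x)
    lift⁻ (∃′ s φ)   ρ (x , h) = x , lift⁻ φ (x ∷ ρ) h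

module _ {𝓘 : Signature ⊤} {L : Language} {ℓ} {𝓜 𝓝 : Structure (ArraySignature 𝓘 L) ℓ} where
  private
    module M = Structure 𝓜
    module N = Structure 𝓝

  map-map⁺ : ∀ {ss : List ⊤} (f : ∀ s → M.Carrier s → N.Carrier s) (xs : All (λ _ → M.Carrier INDEX) ss) →
             All.map (λ {s} → f s) (map⁺ {f = λ _ → INDEX} xs) ≡ map⁺ (All.map (f INDEX) xs)
  map-map⁺ f []       = refl
  map-map⁺ f (x ∷ xs) = cong (f INDEX x ∷_) (map-map⁺ f xs)

  reduct-embedding : Embedding 𝓜 𝓝 → Embedding (Reduct.reduct 𝓜) (Reduct.reduct 𝓝)
  reduct-embedding h = record
    { fn        = fn
    ; injective = injective
    ; fun-homo  = λ f xs → trans (fun-homo (idx f) _) (cong (N.funI (idx f)) (map-map⁺ (λ _ → fn) xs))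
    ; rel-homo  = λ r xs → subst (λ ys → _ ⇔ N.relI r ys) (map-map⁺ (λ _ → fn) xs) (rel-homo r (map⁺ xs))
    }
    where
    open Embedding h

-- Arrays inside one model

module ArrayModel {ℓ} (T_I : IndexTheory ℓ) (L : Language)
  (M : Model ℓ (ArrayTheory.arrayTheory T_I L)) where

  open IndexTheory T_I using (theory)
  open Model M

  index : Model ℓ theory
  index = record
    { structure = Reduct.reduct structure
    ; satisfies = λ a → Reduct.lift⁻ structure (Theory.axiom theory a) [] (satisfies (index-axiom a))
    }

  open IndexOrder T_I index public

  Array Elem : Set ℓ
  Array = Carrier ARRAY
  Elem  = Carrier ELEM

  bottom : Elem
  bottom = funI bot []

  read : Array → I → Elem
  read y i = funI rd (y ∷ i ∷ [])

  write : Array → I → Elem → Array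
  write y i e = funI wr (y ∷ i ∷ e ∷ [])

  length : Array → I
  length y = funI len (y ∷ [])

  Diff : Array → Array → I
  Diff x y = funI diff (x ∷ y ∷ [])

  length-write : ∀ y i e → length (write y i e) ≡ length y
  length-write = satisfies len-wr

  write-bottom : ∀ y i → write y i bottom ≡ y
  write-bottom = satisfies wr-bot

  read-write-same : ∀ {y i e} → e ≢ bottom → zeroᴵ ≤ i → i ≤ length y → read (write y i e) i ≡ e
  read-write-same e≢⊥ p q = satisfies rd-wr-same _ _ _ ((λ eq → lift (e≢⊥ eq)) , p , q)

  read-write-other : ∀ y e {i j} → i ≢ j → read (write y i e) j ≡ read y j
  read-write-other y e {i} {j} i≢j = satisfies rd-wr-other y i j e λ eq → lift (i≢j eq)

  read-defined : ∀ {y i} → read y i ≢ bottom → zeroᴵ ≤ i × i ≤ length y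
  read-defined ≢⊥ = proj₁ (satisfies rd-defined _ _) λ eq → lift (≢⊥ eq)

  read-≢⊥ : ∀ {y i} → zeroᴵ ≤ i → i ≤ length y → read y i ≢ bottom
  read-≢⊥ p q eq = lower (proj₂ (satisfies rd-defined _ _) (p , q) eq)

  length-≥0 : ∀ y → zeroᴵ ≤ length y
  length-≥0 = satisfies len-nonneg

  Diff-same : ∀ y → Diff y y ≡ zeroᴵ
  Diff-same = satisfies diff-same

  Diff-differs : ∀ {x y} → x ≢ y → read x (Diff x y) ≢ read y (Diff x y)
  Diff-differs x≢y eq = lower (satisfies diff-differs _ _ (λ p → lift (x≢y p)) eq)

  Diff-max : ∀ {x y i} → Diff x y < i → read x i ≡ read y i
  Diff-max {x} {y} {i} (p , q) = satisfies diff-max x y i (p , λ eq → lift (q eq))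

module _ (em : ∀ {a} → ExcludedMiddle a) {ℓ} (T_I : IndexTheory ℓ) (L : Language)
  (M : Model ℓ (ArrayTheory.arrayTheory T_I L)) where
  open ArrayModel T_I L M

  array-ext : ∀ {x y} → (∀ i → read x i ≡ read y i) → x ≡ y
  array-ext f = decidable-stable em λ x≢y → Diff-differs x≢y (f _)

  read-out : ∀ {y i} → ¬ (zeroᴵ ≤ i × i ≤ length y) → read y i ≡ bottom
  read-out ¬in = decidable-stable em λ ≢⊥ → ¬in (read-defined ≢⊥)

  private
    module At (M′ : Model ℓ (ArrayTheory.arrayTheory T_I L)) = ArrayModel T_I L M′

    -- Copying `bottom` changes nothing by `write-bottom`, but then `i` is outside the common range
    -- and `x` reads `bottom` there too.
    read-write-copy : ∀ {x y} i → length x ≡ length y → read (write x i (read y i)) i ≡ read y i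
    read-write-copy {x} {y} i eq with em {P = read y i ≡ bottom}
    ... | no ≢⊥ = read-write-same ≢⊥ (proj₁ (read-defined ≢⊥))
                    (subst (i ≤_) (sym eq) (proj₂ (read-defined ≢⊥)))
    ... | yes ≡⊥ = trans (cong (λ e → read (write x i e) i) ≡⊥) (trans (cong (λ z → read z i) (write-bottom x i))
                    (trans (read-out λ (p , q) → read-≢⊥ p (subst (i ≤_) eq q) ≡⊥) (sym ≡⊥)))

  -- The last clause holds because every write is made at an index of `M`; it follows the
  -- modification at indices that exist only in a larger model.
  modify : ∀ x y → length x ≡ length y → (K : List I) →
    ∃[ z ] length z ≡ length x ×
      (∀ {i} → i ∈ K → read z i ≡ read y i) ×
      (∀ {i} → i ∉ K → read z i ≡ read x i) ×
      (∀ M′ (h : M ↪ M′) {i} → (∀ j → Embedding.fn h j ≢ i) →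
         At.read M′ (Embedding.fn h z) i ≡ At.read M′ (Embedding.fn h x) i)
  modify x y eq [] = x , refl , (λ ()) , (λ _ → refl) , λ _ _ _ → refl
  modify x y eq (k ∷ K) with modify x y eq K
  ... | z , z-length , z-in , z-out , z-ext =
    write z k (read y k) , trans (length-write _ _ _) z-length , in′ , out′ , ext′
    where
    in′ : ∀ {i} → i ∈ k ∷ K → read (write z k (read y k)) i ≡ read y i
    in′ {i} i∈ with em {P = k ≡ i} | i∈
    ... | yes refl | _ = read-write-copy k (trans z-length eq)
    ... | no k≢i | here i≡k = contradiction (sym i≡k) k≢i
    ... | no k≢i | there i∈K = trans (read-write-other _ _ k≢i) (z-in i∈K)

    out′ : ∀ {i} → i ∉ k ∷ K → read (write z k (read y k)) i ≡ read x i
    out′ i∉ = trans (read-write-other _ _ λ k≡i → i∉ (here (sym k≡i))) (z-out (i∉ ∘ there))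

    ext′ : ∀ M′ (h : M ↪ M′) {i} → (∀ j → Embedding.fn h j ≢ i) →
           At.read M′ (Embedding.fn h (write z k (read y k))) i ≡ At.read M′ (Embedding.fn h x) i
    ext′ M′ h {i} i∉ = trans
      (trans (cong (λ w → At.read M′ w i) (Embedding.fun-homo h wr _)) (At.read-write-other M′ _ _ (i∉ k)))
      (z-ext M′ h i∉)

  -- The index is Diff z y, where z is x modified to agree with y on K.
  residual : ∀ x y → length x ≡ length y → (K : List I) →
    ∃[ m ] ((m ≡ zeroᴵ × (∀ i → i ∉ K → read x i ≡ read y i)) ⊎ (m ∉ K × read x m ≢ read y m)) ×
      (∀ i → m < i → i ∉ K → read x i ≡ read y i) ×
      (∀ M′ (h : M ↪ M′) {i} → (∀ j → Embedding.fn h j ≢ i) → At._<_ M′ (Embedding.fn h m) i →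
         At.read M′ (Embedding.fn h x) i ≡ At.read M′ (Embedding.fn h y) i)
  residual x y eq K with modify x y eq K
  ... | z , _ , z-in , z-out , z-ext = Diff z y , wit , tail , ext
    where
    wit : (Diff z y ≡ zeroᴵ × (∀ i → i ∉ K → read x i ≡ read y i)) ⊎
          (Diff z y ∉ K × read x (Diff z y) ≢ read y (Diff z y))
    wit with em {P = z ≡ y}
    ... | yes refl = inj₁ (Diff-same y , λ _ i∉ → sym (z-out i∉))
    ... | no z≢y = inj₂ (m∉ , λ p → Diff-differs z≢y (trans (z-out m∉) p))
      where
      m∉ : Diff z y ∉ K
      m∉ m∈ = Diff-differs z≢y (z-in m∈)

    tail : ∀ i → Diff z y < i → i ∉ K → read x i ≡ read y i
    tail _ m<i i∉ = trans (sym (z-out i∉)) (Diff-max m<i)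

    ext : ∀ M′ (h : M ↪ M′) {i} → (∀ j → Embedding.fn h j ≢ i) → At._<_ M′ (Embedding.fn h (Diff z y)) i →
          At.read M′ (Embedding.fn h x) i ≡ At.read M′ (Embedding.fn h y) i
    ext M′ h i∉ m<i = trans (sym (z-ext M′ h i∉))
      (At.Diff-max M′ (subst (λ m → At._<_ M′ m _) (Embedding.fun-homo h diff _) m<i))

-- The index sort of the amalgam

_∘ᴱ_ : ∀ {Sort : Set} {𝓢 : Signature Sort} {ℓ} {M N K : Structure 𝓢 ℓ} →
       Embedding N K → Embedding M N → Embedding M K
_∘ᴱ_ {K = K} g f = record
  { fn        = G.fn ∘ F.fn
  ; injective = F.injective ∘ G.injective
  ; fun-homo  = λ h xs → trans (cong G.fn (F.fun-homo h xs))
                  (trans (G.fun-homo h _) (cong (Structure.funI K h) (map-∘ xs)))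
  ; rel-homo  = λ r xs → mk⇔
      (subst (Structure.relI K r) (map-∘ xs) ∘ Equivalence.to (G.rel-homo r _) ∘ Equivalence.to (F.rel-homo r xs))
      (Equivalence.from (F.rel-homo r xs) ∘ Equivalence.from (G.rel-homo r _) ∘ subst (Structure.relI K r) (sym (map-∘ xs)))
  }
  where
  module F = Embedding f
  module G = Embedding g

-- The two models to be amalgamated are indexed by Bool.
record IndexAmalgam {ℓ} (T_I : IndexTheory ℓ) (B : Model ℓ (IndexTheory.theory T_I))
  (C : Bool → Model ℓ (IndexTheory.theory T_I)) (κ : ∀ s → B ↪ C s) : Set (lsuc ℓ) where
  open IndexTheory T_I using (theory)

  field
    N : Model ℓ theory
    ν : ∀ s → C s ↪ N

  open IndexOrder T_I N

  J : Set ℓ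
  J = Σ[ s ∈ Bool ] Model.Carrier (C s) tt

  at : J → I
  at (s , i) = Embedding.fn (ν s) i

  field
    commute : ∀ s t i → at (s , Embedding.fn (κ s) i) ≡ at (t , Embedding.fn (κ t) i)
    strong  : ∀ {s t} → s ≢ t → ∀ i j → at (s , i) ≡ at (t , j) →
              ∃[ b ] i ≡ Embedding.fn (κ s) b × Embedding.fn (κ t) b ≡ j
    gap            : (J → Bool) → ℕ → I
    gap-above      : ∀ {U} → Cut T_I N at U → ∀ {v} → ¬ T (U v) → ∀ n → at v < gap U n
    gap-below      : ∀ {U} → Cut T_I N at U → ∀ {u} → T (U u) → ∀ n → gap U n < at u
    gap-descending : ∀ {U} → Cut T_I N at U → ∀ n → gap U (suc n) < gap U n

module _ (em : ∀ {a} → ExcludedMiddle a) (funext : ∀ {a b} → Extensionality a b)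
  {ℓ} (T_I : IndexTheory ℓ) where
  open IndexTheory T_I using (theory; strongAmalgamation)

  index-amalgam : ∀ B C κ → IndexAmalgam T_I B C κ
  index-amalgam B C κ with strongAmalgamation (C true) (C false) B (κ true) (κ false)
  ... | N₀ , μ₁ , μ₂ , agree , sep = record
    { N              = extension
    ; ν              = λ s → inclusion ∘ᴱ μ s
    ; commute        = λ { true  true  i → refl
                         ; true  false i → cong I.fn (agree i)
                         ; false true  i → cong I.fn (sym (agree i))
                         ; false false i → refl }
    ; strong         = λ { {true}  {true}  s≢t → contradiction refl s≢t
                         ; {true}  {false} _ i j eq → sep i j (I.injective eq)
                         ; {false} {true}  _ i j eq → swap (sep j i (I.injective (sym eq)))
                         ; {false} {false} s≢t → contradiction refl s≢t }
    ; gap            = gap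
    ; gap-above      = λ cut v∉ → gap-above (restrict cut) v∉
    ; gap-below      = λ cut u∈ → gap-below (restrict cut) u∈
    ; gap-descending = λ cut → gap-descending (restrict cut)
    }
    where
    μ : ∀ s → C s ↪ N₀
    μ true  = μ₁
    μ false = μ₂

    p : Σ[ s ∈ Bool ] Model.Carrier (C s) tt → Model.Carrier N₀ tt
    p (s , i) = Embedding.fn (μ s) i

    open Filling em funext T_I N₀ p
    module I = Embedding inclusion
    open Monotone T_I {N₀} {extension} inclusion

    -- A cut speaks about the points `p` only, and embeddings preserve and reflect their order, so
    -- it is already a cut of `N₀`, where the sequences were chosen.
    restrict : ∀ {U} → Cut T_I extension (I.fn ∘ p) U → Cut T_I N₀ p U
    restrict cut = record
      { upward   = upward ∘ ≤⁺
      ; low      = low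
      ; low∉     = low∉
      ; high     = high
      ; high∈    = high∈
      ; infinite = λ v∉ u∈ L → let j , v<j , j<u , j∉ = infinite v∉ u∈ (map I.fn L) in
                     j , <⁻ v<j , <⁻ j<u , j∉ ∘ ∈-map⁺ I.fn
      }
      where
      open Cut cut

    swap : ∀ {s t i j} → ∃[ b ] i ≡ Embedding.fn (κ s) b × Embedding.fn (κ t) b ≡ j →
           ∃[ b ] j ≡ Embedding.fn (κ t) b × Embedding.fn (κ s) b ≡ i
    swap (b , p , q) = b , sym q , sym p

-- Elements of the amalgam and extension of base arrays

module Amalgam (em : ∀ {a} → ExcludedMiddle a) (funext : ∀ {a b} → Extensionality a b)
  {ℓ} (T_I : IndexTheory ℓ) (L : Language)
  (A : Model ℓ (ArrayTheory.arrayTheory T_I L))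
  (M : Bool → Model ℓ (ArrayTheory.arrayTheory T_I L)) (ι : ∀ s → A ↪ M s)
  (𝓐 : IndexAmalgam T_I (ArrayModel.index T_I L A) (λ s → ArrayModel.index T_I L (M s))
         (λ s → reduct-embedding (ι s))) where

  open Classical em funext
  open IndexAmalgam 𝓐
  open IndexOrder T_I N
  private
    module A = ArrayModel T_I L A
    module S (s : Bool) = ArrayModel T_I L (M s)
    module Mono (s : Bool) = Monotone T_I {S.index s} {N} (ν s)
    module ι s = Embedding (ι s)
    module ν s = Embedding (ν s)

  ⟨_⟩ : ∀ s → S.I s → I
  ⟨ s ⟩ i = ν.fn s i

  νA : A.I → I
  νA i = ⟨ true ⟩ (ι.fn true i)

  ν-ι : ∀ s i → ⟨ s ⟩ (ι.fn s i) ≡ νA i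
  ν-ι s i = commute s true i

  ν-injective : ∀ s {i j} → ⟨ s ⟩ i ≡ ⟨ s ⟩ j → i ≡ j
  ν-injective s = ν.injective s

  νA-injective : ∀ {i j} → νA i ≡ νA j → i ≡ j
  νA-injective = ι.injective true ∘ ν-injective true

  ν-zero : ∀ s → ⟨ s ⟩ (S.zeroᴵ s) ≡ zeroᴵ
  ν-zero s = ν.fun-homo s zero []

  InRange : I → I → Set ℓ
  InRange l k = zeroᴵ ≤ k × k ≤ l

  range⁺ : ∀ s {l i} → S._≤_ s (S.zeroᴵ s) i × S._≤_ s i l → InRange (⟨ s ⟩ l) (⟨ s ⟩ i)
  range⁺ s (p , q) = subst (_≤ _) (ν-zero s) (Mono.≤⁺ s p) , Mono.≤⁺ s q

  range⁻ : ∀ s {l i} → InRange (⟨ s ⟩ l) (⟨ s ⟩ i) → S._≤_ s (S.zeroᴵ s) i × S._≤_ s i l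
  range⁻ s (p , q) = Mono.≤⁻ s (subst (_≤ _) (sym (ν-zero s)) p) , Mono.≤⁻ s q

  -- inj₂ (s , nothing) is a fresh element; distinct sides get distinct ones.
  Elem : Set ℓ
  Elem = A.Elem ⊎ Σ[ s ∈ Bool ] Maybe (S.Elem s)

  ⊥ᴱ elᴱ : Elem
  ⊥ᴱ  = inj₁ A.bottom
  elᴱ = inj₁ (Model.funI A el [])

  fresh : Bool → Elem
  fresh s = inj₂ (s , nothing)

  abstract
    elem : ∀ s → S.Elem s → Elem
    elem s e with em {P = ∃[ a ] ι.fn s a ≡ e}
    ... | yes (a , _) = inj₁ a
    ... | no _        = inj₂ (s , just e)

    elem-ι : ∀ s a → elem s (ι.fn s a) ≡ inj₁ a
    elem-ι s a with em {P = ∃[ a′ ] ι.fn s a′ ≡ ι.fn s a}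
    ... | yes (a′ , eq) = cong inj₁ (ι.injective s eq)
    ... | no ¬a         = contradiction (a , refl) ¬a

    elem-injective : ∀ s {e e′} → elem s e ≡ elem s e′ → e ≡ e′
    elem-injective s {e} {e′} eq
      with em {P = ∃[ a ] ι.fn s a ≡ e} | em {P = ∃[ a ] ι.fn s a ≡ e′}
    elem-injective s refl | yes (a , refl) | yes (.a , refl) = refl
    elem-injective s refl | no _           | no _            = refl

  elem-bottom : ∀ s → elem s (S.bottom s) ≡ ⊥ᴱ
  elem-bottom s = trans (cong (elem s) (sym (ι.fun-homo s bot []))) (elem-ι s _)

  elem-bottom⁻ : ∀ s {e} → elem s e ≡ ⊥ᴱ → e ≡ S.bottom s
  elem-bottom⁻ s eq = elem-injective s (trans eq (sym (elem-bottom s)))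

  elem-el : ∀ s → elem s (Model.funI (M s) el []) ≡ elᴱ
  elem-el s = trans (cong (elem s) (sym (ι.fun-homo s el []))) (elem-ι s _)

  ⊥≢el : ⊥ᴱ ≢ elᴱ
  ⊥≢el eq = lower (Model.satisfies A bot≠el (inj₁-injective eq))

  read-ι : ∀ s c i → S.read s (ι.fn s c) (ι.fn s i) ≡ ι.fn s (A.read c i)
  read-ι s c i = sym (ι.fun-homo s rd _)

  length-ι : ∀ s c → ⟨ s ⟩ (S.length s (ι.fn s c)) ≡ νA (A.length c)
  length-ι s c = trans (cong ⟨ s ⟩ (sym (ι.fun-homo s len _))) (ν-ι s _)

  private
    by : {P : Set a} {X : Set b} → Dec P → (P → X) → X → X
    by (yes p) f x = f p
    by (no _)  f x = x

    by-yes : {P : Set a} {X : Set b} (d : Dec P) {f : P → X} {x y : X} → (∀ p → f p ≡ y) → P → by d f x ≡ y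
    by-yes (yes p) h _ = h p
    by-yes (no ¬p) h p = contradiction p ¬p

    by-no : {P : Set a} {X : Set b} (d : Dec P) {f : P → X} {x : X} → ¬ P → by d f x ≡ x
    by-no (yes p) ¬p = contradiction p ¬p
    by-no (no _)  _  = refl

  Old : Bool → I → Set ℓ
  Old s k = ∃[ i ] ⟨ s ⟩ i ≡ k

  elem-ι-read : ∀ s c i → elem s (S.read s (ι.fn s c) (ι.fn s i)) ≡ inj₁ (A.read c i)
  elem-ι-read s c i = trans (cong (elem s) (read-ι s c i)) (elem-ι s _)

  abstract
    extendᴬ : A.Array → I → Elem
    extendᴬ c k = by (em {P = ∃[ j ] at j ≡ k}) (λ ((t , i) , _) → elem t (S.read t (ι.fn t c) i))
                  (by (em {P = InRange (νA (A.length c)) k}) (λ _ → elᴱ) ⊥ᴱ)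

    -- Independence of the side: by `strong`, an index shared by the two models comes from `A`, and
    -- both models read there what `A` reads.
    extendᴬ-at : ∀ c t i → extendᴬ c (⟨ t ⟩ i) ≡ elem t (S.read t (ι.fn t c) i)
    extendᴬ-at c t i = by-yes em (λ ((t′ , i′) , eq) → unique t′ i′ eq) ((t , i) , refl)
      where
      unique : ∀ t′ i′ → ⟨ t′ ⟩ i′ ≡ ⟨ t ⟩ i →
               elem t′ (S.read t′ (ι.fn t′ c) i′) ≡ elem t (S.read t (ι.fn t c) i)
      unique t′ i′ eq with t′ Bool.≟ t
      ... | yes refl = cong (λ i → elem t (S.read t (ι.fn t c) i)) (ν-injective t eq)
      ... | no t′≢t with strong t′≢t i′ i eq
      ...   | a , refl , refl = trans (elem-ι-read t′ c a) (sym (elem-ι-read t c a))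

    extendᴬ-new : ∀ c {k} → ¬ (∃[ j ] at j ≡ k) → InRange (νA (A.length c)) k → extendᴬ c k ≡ elᴱ
    extendᴬ-new c ¬j r = trans (by-no em ¬j) (by-yes em (λ _ → refl) r)

    read-out′ : ∀ s {y i} → ¬ InRange (⟨ s ⟩ (S.length s y)) (⟨ s ⟩ i) → S.read s y i ≡ S.bottom s
    read-out′ s ¬r = read-out em T_I L (M s) (¬r ∘ range⁺ s)

    extendᴬ-out : ∀ c {k} → ¬ InRange (νA (A.length c)) k → extendᴬ c k ≡ ⊥ᴱ
    extendᴬ-out c {k} ¬r with em {P = ∃[ j ] at j ≡ k}
    ... | no ¬j = by-no em ¬r
    ... | yes ((t , i) , refl) = trans
          (cong (elem t) (read-out′ t (¬r ∘ subst (λ l → InRange l (⟨ t ⟩ i)) (length-ι t c)))) (elem-bottom t)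

    extendᴬ-in : ∀ c {k} → InRange (νA (A.length c)) k → extendᴬ c k ≢ ⊥ᴱ
    extendᴬ-in c {k} r with em {P = ∃[ j ] at j ≡ k}
    ... | no ¬j = λ eq → ⊥≢el (sym (trans (sym (by-yes em (λ _ → refl) r)) eq))
    ... | yes ((t , i) , refl) = λ eq → let p , q = range⁻ t (subst (λ l → InRange l (⟨ t ⟩ i)) (sym (length-ι t c)) r) in
          S.read-≢⊥ t p q (elem-bottom⁻ t eq)

  -- Agreement up to finite sets, and arrays at new indices

  -- Exceptions are listed in the amalgamated index set, so that lists coming from different sides
  -- can be joined.
  AgreeBeyond : ∀ s → S.Array s → S.Array s → I → Set ℓ
  AgreeBeyond s x y k = S.length s x ≡ S.length s y ×
    ∃[ F ] (∀ i → k < ⟨ s ⟩ i → ⟨ s ⟩ i ∉ F → S.read s x i ≡ S.read s y i)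

  agree-sym : ∀ s {x y k} → AgreeBeyond s x y k → AgreeBeyond s y x k
  agree-sym s (eq , F , f) = sym eq , F , λ i p q → sym (f i p q)

  agree-trans : ∀ s {x y z k} → AgreeBeyond s x y k → AgreeBeyond s y z k → AgreeBeyond s x z k
  agree-trans s (eq , F , f) (eq′ , F′ , f′) = trans eq eq′ , F ++ F′ ,
    λ i p q → trans (f i p (q ∘ ∈-++⁺ˡ)) (f′ i p (q ∘ ∈-++⁺ʳ F))

  agree-mono : ∀ s {x y k k′} → k ≤ k′ → AgreeBeyond s x y k → AgreeBeyond s x y k′
  agree-mono s k≤k′ (eq , F , f) = eq , F , λ i p q → f i (≤-<-trans k≤k′ p) q

  preimage : ∀ {X : Set ℓ} (f : X → I) → Injective _≡_ _≡_ f → (F : List I) →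
             ∃[ K ] (∀ x → f x ∈ F → x ∈ K) × (∀ x → x ∈ K → f x ∈ F)
  preimage f inj [] = [] , (λ _ ()) , (λ _ ())
  preimage f inj (k ∷ F) with preimage f inj F | em {P = ∃[ x ] f x ≡ k}
  ... | K , to , from | yes (x , refl) = x ∷ K ,
        (λ { y (here eq) → here (inj eq) ; y (there y∈) → there (to y y∈) }) ,
        (λ { y (here refl) → here refl ; y (there y∈) → there (from y y∈) })
  ... | K , to , from | no ¬x = K ,
        (λ { y (here eq) → contradiction (y , eq) ¬x ; y (there y∈) → to y y∈ }) ,
        (λ y y∈ → there (from y y∈))

  -- Without Const, a length that belongs to the base need not be the length of
  -- an array of the base; Short replaces Near in this case.
  Near : ∀ s → S.Array s → I → A.Array → Set ℓ
  Near s x j c = AgreeBeyond s x (ι.fn s c) j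

  Short : ∀ s → S.Array s → I → Set ℓ
  Short s x k = ∃[ F ] (∀ j → k < at j → at j ≤ ⟨ s ⟩ (S.length s x) → at j ∈ F)

  Tame : ∀ s → S.Array s → J → Set ℓ
  Tame s x j = (∃[ c ] Near s x (at j) c) ⊎ Short s x (at j)

  tame : ∀ s → S.Array s → J → Bool
  tame s x j = ⌊ Tame s x j ⌋

  zeroᴶ : J
  zeroᴶ = true , S.zeroᴵ true

  -- `Short` is absent from `HasNear` as it supplies no base array to copy. Excluding `zeroᴶ` in
  -- `Starred` gives the cut a nonempty lower side.
  HasNear Starred : ∀ s → S.Array s → I → Set ℓ
  HasNear s x k = ∃[ c ] ∃[ j ] Near s x (at j) c × at j < k
  Starred s x k = (∃[ l ] ι.fn s l ≡ S.length s x) × ¬ Tame s x zeroᴶ × ∃[ n ] k ≡ gap (tame s x) n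

  zero< : ∀ s {k} → ¬ Old s k → zeroᴵ ≤ k → zeroᴵ < k
  zero< s ¬old p = p , λ { refl → ¬old (S.zeroᴵ s , ν-zero s) }

  at-zero< : ∀ s {k} → ¬ Old s k → zeroᴵ ≤ k → at zeroᴶ < k
  at-zero< s ¬old p = subst (_< _) (sym (ν-zero true)) (zero< s ¬old p)

  -- Base arrays near `x` agree in `A` beyond `j` outside a finite `K`, so `residual` relative to
  -- `K` yields an index of `A` that is zero or at most `j`. Since `k` is no index of `A`, the law
  -- of `diff` in the model containing `k` gives equality there.
  near-unique-< : ∀ s x {c c′ j k} → Near s x j c → Near s x j c′ → j < k → zeroᴵ ≤ k → ¬ Old s k →
                extendᴬ c k ≡ extendᴬ c′ k
  near-unique-< s x {c} {c′} {j} {k} n n′ j<k 0≤k ¬old = by-case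
    where
    same-length : A.length c ≡ A.length c′
    same-length = νA-injective (trans (sym (length-ι s c))
      (trans (cong ⟨ s ⟩ (trans (sym (proj₁ n)) (proj₁ n′))) (length-ι s c′)))

    both : AgreeBeyond s (ι.fn s c) (ι.fn s c′) j
    both = agree-trans s (agree-sym s n) n′

    F : List I
    F = proj₁ (proj₂ both)

    K : List A.I
    K = proj₁ (preimage νA νA-injective F)

    agreeᴬ : ∀ m → j < νA m → m ∉ K → A.read c m ≡ A.read c′ m
    agreeᴬ m j<m m∉ = ι.injective s (trans (sym (read-ι s c m)) (trans
      (proj₂ (proj₂ both) (ι.fn s m) (subst (j <_) (sym (ν-ι s m)) j<m)
        (m∉ ∘ proj₁ (proj₂ (preimage νA νA-injective F)) m ∘ subst (_∈ F) (ν-ι s m)))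
      (read-ι s c′ m)))

    by-case : extendᴬ c k ≡ extendᴬ c′ k
    by-case with em {P = InRange (νA (A.length c)) k}
    ... | no ¬r = trans (extendᴬ-out c ¬r)
          (sym (extendᴬ-out c′ (¬r ∘ subst (λ l → InRange (νA l) k) (sym same-length))))
    ... | yes r with em {P = ∃[ j ] at j ≡ k}
    ...   | no ¬j = trans (extendᴬ-new c ¬j r)
          (sym (extendᴬ-new c′ ¬j (subst (λ l → InRange (νA l) k) same-length r)))
    ...   | yes ((t , i) , refl) = trans (extendᴬ-at c t i)
          (trans (cong (elem t) (same-read (residual em T_I L A c c′ same-length K))) (sym (extendᴬ-at c′ t i)))
      where
      same-read : _ → S.read t (ι.fn t c) i ≡ S.read t (ι.fn t c′) i
      same-read (m , wit , _ , ext) = ext (M t) (ι t)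
        (λ { i′ refl → ¬old (ι.fn s i′ , trans (ν-ι s i′) (sym (ν-ι t i′))) })
        (Mono.<⁻ t (subst (_< ⟨ t ⟩ i) (sym (ν-ι t m)) (m< wit)))
        where
        m< : (m ≡ A.zeroᴵ × _) ⊎ (m ∉ K × A.read c m ≢ A.read c′ m) → νA m < ⟨ t ⟩ i
        -- Zero is an old index and `k` is not, so `0 ≤ k` is strict.
        m< (inj₁ (refl , _)) = subst (_< _)
          (trans (sym (ν-zero true)) (cong ⟨ true ⟩ (sym (ι.fun-homo true (idx zero) [])))) (zero< s ¬old 0≤k)
        m< (inj₂ (m∉ , ≢)) = ≤-<-trans (≮⇒≥ em λ j<m → ≢ (agreeᴬ m j<m m∉)) j<k

  near-unique : ∀ s x {c c′ j j′ k} → Near s x j c → Near s x j′ c′ → j < k → j′ < k → zeroᴵ ≤ k → ¬ Old s k →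
                extendᴬ c k ≡ extendᴬ c′ k
  near-unique s x {c} {c′} {j} {j′} n n′ j<k j′<k with total j j′
  ... | inj₁ j≤j′ = near-unique-< s x {c} {c′} (agree-mono s j≤j′ n) n′ j′<k
  ... | inj₂ j′≤j = near-unique-< s x {c} {c′} n (agree-mono s j′≤j n′) j<k

  abstract
    -- The fresh value is used only if the length is in the base: otherwise no
    -- array of the other side has this length, and el is the value required of
    -- the constant arrays.
    extend : ∀ s → S.Array s → I → Elem
    extend s x k =
      by (em {P = Old s k}) (λ (i , _) → elem s (S.read s x i))
      (by (em {P = InRange (⟨ s ⟩ (S.length s x)) k})
        (λ _ → by (em {P = HasNear s x k}) (λ (c , _) → extendᴬ c k)
               (by (em {P = Starred s x k}) (λ _ → fresh s) elᴱ))
        ⊥ᴱ)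

    extend-old : ∀ s x i → extend s x (⟨ s ⟩ i) ≡ elem s (S.read s x i)
    extend-old s x i = by-yes em (λ (j , eq) → cong (elem s ∘ S.read s x) (ν-injective s eq)) (i , refl)

    extend-out : ∀ s x {k} → ¬ Old s k → ¬ InRange (⟨ s ⟩ (S.length s x)) k → extend s x k ≡ ⊥ᴱ
    extend-out s x ¬old ¬r = trans (by-no em ¬old) (by-no em ¬r)

    extend-near : ∀ s x {k} → ¬ Old s k → InRange (⟨ s ⟩ (S.length s x)) k →
                  ∀ {c j} → Near s x (at j) c → at j < k → extend s x k ≡ extendᴬ c k
    extend-near s x ¬old r {c} {j} n j<k = trans (by-no em ¬old) (by-yes em (λ _ → by-yes em
      (λ (c′ , j′ , n′ , j′<k) → near-unique s x {c′} {c} n′ n j′<k j<k (proj₁ r) ¬old) (c , j , n , j<k)) r)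

    extend-starred : ∀ s x {k} → ¬ Old s k → InRange (⟨ s ⟩ (S.length s x)) k →
                     ¬ HasNear s x k → Starred s x k → extend s x k ≡ fresh s
    extend-starred s x ¬old r ¬n st = trans (by-no em ¬old) (by-yes em (λ _ →
      trans (by-no em ¬n) (by-yes em (λ _ → refl) st)) r)

    extend-plain : ∀ s x {k} → ¬ Old s k → InRange (⟨ s ⟩ (S.length s x)) k →
                   ¬ HasNear s x k → ¬ Starred s x k → extend s x k ≡ elᴱ
    extend-plain s x ¬old r ¬n ¬st = trans (by-no em ¬old) (by-yes em (λ _ →
      trans (by-no em ¬n) (by-no em ¬st)) r)

  tame-upward : ∀ s x {j j′} → at j ≤ at j′ → Tame s x j → Tame s x j′
  tame-upward s x p (inj₁ (c , n)) = inj₁ (c , agree-mono s p n)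
  tame-upward s x p (inj₂ (F , f)) = inj₂ (F , λ i q → f i (≤-<-trans p q))

  tame-agree : ∀ s {x y k j} → AgreeBeyond s x y k → k ≤ at j → Tame s x j → Tame s y j
  tame-agree s e p (inj₁ (c , n)) = inj₁ (c , agree-trans s (agree-sym s (agree-mono s p e)) n)
  tame-agree s {j = j} e p (inj₂ (F , f)) =
    inj₂ (F , λ i q r → f i q (subst (λ l → at i ≤ ⟨ s ⟩ l) (sym (proj₁ e)) r))

  tame-high : ∀ s x → Tame s x (s , S.length s x)
  tame-high s x = inj₂ ([] , λ j p q → contradiction q (<⇒≱ p))

  -- A finite interval next to a tame index would make its lower end tame.
  tame-cut : ∀ s x → ¬ Tame s x zeroᴶ → Cut T_I N at (tame s x)
  tame-cut s x ¬zero = record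
    { upward   = λ p t → ⌊⌋⁺ (tame-upward s x p (⌊⌋⁻ t))
    ; low      = zeroᴶ
    ; low∉     = λ t → ¬zero (⌊⌋⁻ t)
    ; high     = s , S.length s x
    ; high∈    = ⌊⌋⁺ (tame-high s x)
    ; infinite = λ {v} {u} v∉ u∈ F → stable λ none → v∉ (⌊⌋⁺ (lower-end v u F
                   (λ j p q → stable λ j∉ → none (j , p , q , j∉)) (⌊⌋⁻ u∈)))
    }
    where
    split : ∀ v u F → (∀ j → at v < at j → at j < at u → at j ∈ F) → ∀ j → at v < at j →
            at j ∈ at u ∷ F ⊎ at u < at j
    split v u F f j p with ≤-or-> em (at j) (at u) | em {P = at j ≡ at u}
    ... | inj₂ q | _       = inj₂ q
    ... | inj₁ q | yes eq  = inj₁ (here eq)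
    ... | inj₁ q | no k≢    = inj₁ (there (f j p (q , k≢)))

    lower-end : ∀ v u F → (∀ j → at v < at j → at j < at u → at j ∈ F) → Tame s x u → Tame s x v
    lower-end v u F f (inj₁ (c , eq , G , g)) = inj₁ (c , eq , (at u ∷ F) ++ G , g′)
      where
      g′ : ∀ i → at v < ⟨ s ⟩ i → ⟨ s ⟩ i ∉ (at u ∷ F) ++ G → S.read s x i ≡ S.read s (ι.fn s c) i
      g′ i p i∉ with split v u F f (s , i) p
      ... | inj₁ i∈ = contradiction (∈-++⁺ˡ i∈) i∉
      ... | inj₂ q  = g i q (i∉ ∘ ∈-++⁺ʳ (at u ∷ F))
    lower-end v u F f (inj₂ (G , g)) = inj₂ ((at u ∷ F) ++ G , g′)
      where
      g′ : ∀ j → at v < at j → at j ≤ ⟨ s ⟩ (S.length s x) → at j ∈ (at u ∷ F) ++ G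
      g′ j p q with split v u F f j p
      ... | inj₁ j∈ = ∈-++⁺ˡ j∈
      ... | inj₂ r  = ∈-++⁺ʳ (at u ∷ F) (g j r q)

  near-agree : ∀ s {x y j k} → AgreeBeyond s x y (at j) → at j < k → ∀ {c j′} → Near s x (at j′) c → at j′ < k →
               ∃[ i ] Near s y (at i) c × at i < k
  near-agree s {j = j} e p {j′ = j′} n q with total (at j) (at j′)
  ... | inj₁ r = j′ , agree-trans s (agree-sym s (agree-mono s r e)) n , q
  ... | inj₂ r = j , agree-trans s (agree-sym s e) (agree-mono s r n) , p

  -- A star lies below all tame indices, so `j` is not tame for `x`, and then not for `y`. Hence all
  -- tame indices of both lie at or above `j`, where agreement makes the tame sets equal; `gap`
  -- depends on nothing else.
  starred-agree : ∀ s {x y j k} → AgreeBeyond s x y (at j) → at j < k → Starred s x k → Starred s y k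
  starred-agree s {x} {y} {j} e p ((l , l≡) , ¬zero , n , refl) =
    (l , trans l≡ (proj₁ e)) ,
    (λ t → ¬zero (⌊⌋⁻ (subst (λ U → T (U zeroᴶ)) (sym tame≡) (⌊⌋⁺ t)))) ,
    n , cong (λ U → gap U n) tame≡
    where
    ¬xj : ¬ Tame s x j
    ¬xj t = <-irrefl (<-trans p (gap-below (tame-cut s x ¬zero) {j} (⌊⌋⁺ t) n))

    ¬yj : ¬ Tame s y j
    ¬yj t = ¬xj (tame-agree s (agree-sym s e) ≤-refl t)

    beyond : ∀ z → ¬ Tame s z j → ∀ {i} → Tame s z i → at j ≤ at i
    beyond z ¬zj t = ≮⇒≥ em λ q → ¬zj (tame-upward s z (proj₁ q) t)

    tame≡ : tame s x ≡ tame s y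
    tame≡ = funext λ i → ⌊⌋-cong
      (λ t → tame-agree s e (beyond x ¬xj t) t)
      (λ t → tame-agree s (agree-sym s e) (beyond y ¬yj t) t)

  -- This is why `Diff` of one model survives: at a new index beyond `j`, the value depends only on
  -- the length and on the reads beyond `j` up to finitely many.
  extend-agree : ∀ s {x y j k} → AgreeBeyond s x y (at j) → ¬ Old s k → at j < k → extend s x k ≡ extend s y k
  extend-agree s {x} {y} {j} {k} e ¬old p with em {P = InRange (⟨ s ⟩ (S.length s x)) k}
  ... | no ¬r = trans (extend-out s x ¬old ¬r)
                  (sym (extend-out s y ¬old (¬r ∘ subst (λ l → InRange (⟨ s ⟩ l) k) (sym (proj₁ e)))))
  ... | yes r with subst (λ l → InRange (⟨ s ⟩ l) k) (proj₁ e) r | em {P = HasNear s x k}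
  ...   | r′ | yes (c , _ , n , q) with near-agree s {j = j} e p {c} n q
  ...     | i , n′ , q′ = trans (extend-near s x ¬old r {c} n q) (sym (extend-near s y ¬old r′ {c} n′ q′))
  extend-agree s {x} {y} {j} {k} e ¬old p | yes r | r′ | no ¬n with em {P = Starred s x k}
  ... | yes st = trans (extend-starred s x ¬old r ¬n st) (sym (extend-starred s y ¬old r′ (¬n ∘ near′)
                   (starred-agree s {j = j} e p st)))
    where
    near′ : HasNear s y k → HasNear s x k
    near′ (c , i , n , q) = c , near-agree s {j = j} (agree-sym s e) p {c} n q
  ... | no ¬st = trans (extend-plain s x ¬old r ¬n ¬st) (sym (extend-plain s y ¬old r′ (¬n ∘ near′)
                   (¬st ∘ starred-agree s {j = j} (agree-sym s e) p)))
    where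
    near′ : HasNear s y k → HasNear s x k
    near′ (c , i , n , q) = c , near-agree s {j = j} (agree-sym s e) p {c} n q

  extend-ι : ∀ s c k → extend s (ι.fn s c) k ≡ extendᴬ c k
  extend-ι s c k with em {P = Old s k}
  ... | yes (i , refl) = trans (extend-old s (ι.fn s c) i) (sym (extendᴬ-at c s i))
  ... | no ¬old with em {P = InRange (⟨ s ⟩ (S.length s (ι.fn s c))) k}
  ...   | no ¬r = trans (extend-out s (ι.fn s c) ¬old ¬r)
                    (sym (extendᴬ-out c (¬r ∘ subst (λ l → InRange l k) (sym (length-ι s c)))))
  ...   | yes r = extend-near s (ι.fn s c) ¬old r {c} {zeroᴶ} (refl , [] , λ _ _ _ → refl)
                    (at-zero< s ¬old (proj₁ r))

  extend-outside : ∀ s x {k} → ¬ InRange (⟨ s ⟩ (S.length s x)) k → extend s x k ≡ ⊥ᴱ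
  extend-outside s x {k} ¬r with em {P = Old s k}
  ... | yes (i , refl) = trans (extend-old s x i) (trans (cong (elem s) (read-out′ s ¬r)) (elem-bottom s))
  ... | no ¬old = extend-out s x ¬old ¬r

  near-length : ∀ s {x k c} → Near s x k c → ⟨ s ⟩ (S.length s x) ≡ νA (A.length c)
  near-length s {c = c} n = trans (cong ⟨ s ⟩ (proj₁ n)) (length-ι s c)

  extend-inside : ∀ s x {k} → InRange (⟨ s ⟩ (S.length s x)) k → extend s x k ≢ ⊥ᴱ
  extend-inside s x {k} r with em {P = Old s k}
  ... | yes (i , refl) = λ eq → let p , q = range⁻ s r in
        S.read-≢⊥ s p q (elem-bottom⁻ s (trans (sym (extend-old s x i)) eq))
  ... | no ¬old with em {P = HasNear s x k} | em {P = Starred s x k}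
  ...   | yes (c , j , n , p) | _ = λ eq →
          extendᴬ-in c (subst (λ l → InRange l k) (near-length s n) r)
            (trans (sym (extend-near s x ¬old r {c} n p)) eq)
  ...   | no ¬n | yes st = λ eq → contradiction (trans (sym (extend-starred s x ¬old r ¬n st)) eq) λ ()
  ...   | no ¬n | no ¬st = λ eq → ⊥≢el (sym (trans (sym (extend-plain s x ¬old r ¬n ¬st)) eq))

  -- Largest differences

  Differ : (f g : I → Elem) → List I → I → Set ℓ
  Differ f g F k = k ∉ F × f k ≢ g k

  HasMax : (I → Set ℓ) → Set ℓ
  HasMax P = ∃[ m ] P m × (∀ k → m < k → ¬ P k)

  -- The list F is needed because arrays are closed under finite modification.
  MaxDiff : (f g : I → Elem) → Set ℓ
  MaxDiff f g = ∀ F k → Differ f g F k → HasMax (Differ f g F)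

  maxDiff-refl : ∀ f → MaxDiff f f
  maxDiff-refl f F k (_ , k≢) = contradiction refl k≢

  maxDiff-sym : ∀ {f g} → MaxDiff f g → MaxDiff g f
  maxDiff-sym md F k (k∉ , k≢) with md F k (k∉ , k≢ ∘ sym)
  ... | m , (m∉ , ≢m) , top = m , (m∉ , ≢m ∘ sym) , λ k p (k∉ , ≢k) → top k p (k∉ , ≢k ∘ sym)

  -- Delete `G` along with `F`. The candidate is the largest difference of `f` and `g` that is left
  -- beyond `k`, or `k` itself if there is none; only elements of `G` can exceed it, and
  -- `finite-max` finishes.
  maxDiff-beyond : ∀ {f g f′ g′} → MaxDiff f g → ∀ F G k → Differ f′ g′ F k →
                   (∀ k′ → k < k′ → k′ ∉ G → f′ k′ ≡ f k′ × g′ k′ ≡ g k′) → HasMax (Differ f′ g′ F)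
  maxDiff-beyond {f} {g} {f′} {g′} md F G k d eqs with em {P = ∃[ k′ ] k < k′ × Differ f g (F ++ G) k′}
  ... | no ¬d = finite-max em (Differ f′ g′ F) G k d λ k′ p (k′∉ , k≢) → stable λ k′∉G →
        ¬d (k′ , p , (λ k∈ → [ k′∉ , k′∉G ]′ (∈-++⁻ F k∈)) ,
            λ eq → let p , q = eqs k′ p k′∉G in k≢ (trans p (trans eq (sym q))))
  ... | yes (k₁ , p₁ , d₁) with md (F ++ G) k₁ d₁
  ...   | m , (m∉ , ≢m) , top = finite-max em (Differ f′ g′ F) G m (m∉ ∘ ∈-++⁺ˡ , ≢m′)
          λ k′ p (k′∉ , k≢) → stable λ k′∉G →
            top k′ p ((λ k∈ → [ k′∉ , k′∉G ]′ (∈-++⁻ F k∈)) ,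
              λ eq → let p , q = eqs k′ (<-trans k<m p) k′∉G in k≢ (trans p (trans eq (sym q))))
    where
    k<m : k < m
    k<m = <-≤-trans p₁ (≮⇒≥ em λ q → top k₁ q d₁)

    ≢m′ : f′ m ≢ g′ m
    ≢m′ eq = let p , q = eqs m k<m (m∉ ∘ ∈-++⁺ʳ F) in ≢m (trans (sym p) (trans eq q))

  both-outside : ∀ s t x y {k} → ⟨ s ⟩ (S.length s x) ≡ ⟨ t ⟩ (S.length t y) →
                 ¬ InRange (⟨ s ⟩ (S.length s x)) k → extend s x k ≡ extend t y k
  both-outside s t x y {k} eq ¬r =
    trans (extend-outside s x ¬r) (sym (extend-outside t y (¬r ∘ subst (λ l → InRange l k) (sym eq))))

  -- `residual` handles the old members of `F` within the model, and new indices above its result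
  -- agree by `extend-agree`. If no old difference is left, all indices outside `F` agree.
  maxDiff-same : ∀ s x y → S.length s x ≡ S.length s y → MaxDiff (extend s x) (extend s y)
  maxDiff-same s x y eq F k (k∉ , k≢) with preimage ⟨ s ⟩ (ν-injective s) F
  ... | K , to , from with residual em T_I L (M s) x y eq K
  ... | m , inj₂ (m∉ , ≢m) , tail , _ = ⟨ s ⟩ m , (m∉ ∘ to m , ≢m′) , λ k p (k∉ , k≢) → k≢ (above k p k∉)
    where
    ≢m′ : extend s x (⟨ s ⟩ m) ≢ extend s y (⟨ s ⟩ m)
    ≢m′ eq = ≢m (elem-injective s (trans (sym (extend-old s x m)) (trans eq (extend-old s y m))))

    agree : ∀ i → ⟨ s ⟩ m < ⟨ s ⟩ i → ⟨ s ⟩ i ∉ F → S.read s x i ≡ S.read s y i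
    agree i p i∉ = tail i (Mono.<⁻ s p) (i∉ ∘ from i)

    above : ∀ k → ⟨ s ⟩ m < k → k ∉ F → extend s x k ≡ extend s y k
    above k p k∉ with em {P = Old s k}
    ... | yes (i , refl) = trans (extend-old s x i) (trans (cong (elem s) (agree i p k∉)) (sym (extend-old s y i)))
    ... | no ¬old = extend-agree s {j = s , m} (eq , F , agree) ¬old p
  ... | m , inj₁ (_ , agree) , _ , _ = contradiction everywhere k≢
    where
    everywhere : extend s x k ≡ extend s y k
    everywhere with em {P = Old s k} | em {P = InRange (⟨ s ⟩ (S.length s x)) k}
    ... | yes (i , refl) | _ =
          trans (extend-old s x i) (trans (cong (elem s) (agree i (k∉ ∘ from i))) (sym (extend-old s y i)))
    ... | no ¬old | no ¬r = both-outside s s x y (cong ⟨ s ⟩ eq) ¬r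
    ... | no ¬old | yes r = extend-agree s {j = zeroᴶ} (eq , F , λ i _ i∉ → agree i (i∉ ∘ from i)) ¬old
                              (at-zero< s ¬old (proj₁ r))

  near-beyond : ∀ s x {c j} (n : Near s x (at j) c) → ∀ k → at j < k → k ∉ proj₁ (proj₂ n) →
                extend s x k ≡ extendᴬ c k
  near-beyond s x {c} {j} n k p k∉ with em {P = Old s k} | em {P = InRange (⟨ s ⟩ (S.length s x)) k}
  ... | yes (i , refl) | _ = trans (extend-old s x i)
        (trans (cong (elem s) (proj₂ (proj₂ n) i p k∉)) (sym (extendᴬ-at c s i)))
  ... | no ¬old | no ¬r = trans (extend-out s x ¬old ¬r)
        (sym (extendᴬ-out c (¬r ∘ subst (λ l → InRange l k) (sym (near-length s n)))))
  ... | no ¬old | yes r = extend-near s x ¬old r {c} n p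

  New : I → Set ℓ
  New k = ¬ (∃[ j ] at j ≡ k)

  new-not-old : ∀ s {k} → New k → ¬ Old s k
  new-not-old s new (i , eq) = new ((s , i) , eq)

  data NewValue s x k : Set ℓ where
    plain   : extend s x k ≡ elᴱ → NewValue s x k
    starred : extend s x k ≡ fresh s → ¬ Tame s x zeroᴶ → ∀ n → k ≡ gap (tame s x) n → NewValue s x k

  new-value : ∀ s x {k} → New k → InRange (⟨ s ⟩ (S.length s x)) k → NewValue s x k
  new-value s x {k} new r with em {P = HasNear s x k} | em {P = Starred s x k}
  ... | yes (c , _ , n , p) | _ = plain (trans (extend-near s x (new-not-old s new) r {c} n p)
        (extendᴬ-new c new (subst (λ l → InRange l k) (near-length s n) r)))
  ... | no ¬n | yes st@(_ , ¬zero , n , eq) =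
        starred (extend-starred s x (new-not-old s new) r ¬n st) ¬zero n eq
  ... | no ¬n | no ¬st = plain (extend-plain s x (new-not-old s new) r ¬n ¬st)

  -- Stars lie below every tame index, and base arrays take the value `elᴱ` at indices outside both
  -- models.
  new-plain : ∀ s x {j k} → Tame s x j → at j < k → New k → InRange (⟨ s ⟩ (S.length s x)) k → extend s x k ≡ elᴱ
  new-plain s x {j} t p new r with new-value s x new r
  ... | plain eq = eq
  ... | starred _ ¬zero n refl =
        contradiction (<-trans p (gap-below (tame-cut s x ¬zero) {j} (⌊⌋⁺ t) n)) <-irrefl

  gap-new : ∀ s x → ¬ Tame s x zeroᴶ → ∀ n → New (gap (tame s x) n)
  gap-new s x ¬zero n (j , eq) with em {P = Tame s x j}
  ... | yes t = <-irrefl (subst (_< at j) (sym eq) (gap-below (tame-cut s x ¬zero) {j} (⌊⌋⁺ t) n))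
  ... | no ¬t = <-irrefl (subst (at j <_) (sym eq) (gap-above (tame-cut s x ¬zero) {j} (λ t → ¬t (⌊⌋⁻ t)) n))

  descending : ∀ {z : ℕ → I} → (∀ n → z (suc n) < z n) → ∀ {m n} → m ℕ.< n → z n < z m
  descending {z} desc {m} m<n = go (ℕ.≤⇒≤′ m<n)
    where
    go : ∀ {n} → suc m ℕ.≤′ n → z n < z m
    go (ℕ.≤′-reflexive refl) = desc m
    go (ℕ.≤′-step p)         = <-trans (desc _) (go p)

  escape : ∀ {z : ℕ → I} → (∀ n → z (suc n) < z n) → ∀ F → ∃[ n ] ∀ m → n ℕ.≤ m → z m ∉ F
  escape desc [] = 0 , λ _ _ ()
  escape {z} desc (k ∷ F) with escape desc F | em {P = ∃[ n ] z n ≡ k}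
  ... | n , f | no ¬n = n , λ { m p (here eq) → ¬n (m , eq) ; m p (there m∈) → f m p m∈ }
  ... | n , f | yes (n′ , refl) = n ℕ.⊔ suc n′ ,
        λ { m p (here eq) → proj₂ (descending desc (ℕ.≤-trans (ℕ.m≤n⊔m n (suc n′)) p)) eq
          ; m p (there m∈) → f m (ℕ.≤-trans (ℕ.m≤m⊔n n (suc n′)) p) m∈ }

  -- Beyond a common tame point where they differ, both arrays look like arrays
  -- of the base.  If there is no such point, they differ at all the points
  -- that fill the cut of x, and at only finitely many points above any of those.
  maxDiff-cross : ∀ {s t} → s ≢ t → ∀ x y → ⟨ s ⟩ (S.length s x) ≡ ⟨ t ⟩ (S.length t y) →
                  (∀ j → Tame s x j → Tame t y j) → MaxDiff (extend s x) (extend t y)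
  maxDiff-cross {s} {t} s≢t x y eq sub F k (k∉ , k≢)
    with em {P = ∃[ j ] Tame s x j × Differ (extend s x) (extend t y) F (at j)}
  ... | yes (j , tx , d) = tame-case tx (sub j tx)
    where
    short : ∀ G → (∀ i → at j < at i → at i ≤ ⟨ s ⟩ (S.length s x) → at i ∈ G) →
            HasMax (Differ (extend s x) (extend t y) F)
    short G g = finite-max em (Differ (extend s x) (extend t y) F) G (at j) d listed
      where
      listed : ∀ k → at j < k → Differ (extend s x) (extend t y) F k → k ∈ G
      listed k p (_ , k≢) with em {P = InRange (⟨ s ⟩ (S.length s x)) k} | em {P = ∃[ i ] at i ≡ k}
      ... | no ¬r | _              = contradiction (both-outside s t x y eq ¬r) k≢
      ... | yes r | yes (i , refl) = g i p (proj₂ r)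
      ... | yes r | no new         = contradiction (trans (new-plain s x {j} tx p new r)
              (sym (new-plain t y {j} (sub j tx) p new (subst (λ l → InRange l k) eq r)))) k≢

    tame-case : Tame s x j → Tame t y j → HasMax (Differ (extend s x) (extend t y) F)
    tame-case (inj₂ (G , g)) _ = short G g
    tame-case (inj₁ _) (inj₂ (G , g)) = short G λ i p q → g i p (subst (at i ≤_) eq q)
    tame-case (inj₁ (c , n)) (inj₁ (c′ , n′)) = maxDiff-beyond base F (Gx ++ Gy) (at j) d λ k p k∉ →
        near-beyond s x {c} {j} n k p (k∉ ∘ ∈-++⁺ˡ) , near-beyond t y {c′} {j} n′ k p (k∉ ∘ ∈-++⁺ʳ Gx)
      where
      Gx Gy : List I
      Gx = proj₁ (proj₂ n)
      Gy = proj₁ (proj₂ n′)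

      lengths : A.length c ≡ A.length c′
      lengths = νA-injective (trans (sym (near-length s n)) (trans eq (near-length t n′)))

      base : MaxDiff (extendᴬ c) (extendᴬ c′)
      base = subst₂ MaxDiff (funext (extend-ι s c)) (funext (extend-ι s c′))
        (maxDiff-same s _ _ (ν-injective s (trans (length-ι s c) (trans (cong νA lengths) (sym (length-ι s c′))))))
  ... | no none with em {P = Tame s x zeroᴶ}
  ...   | yes t0 = contradiction (no-differ k k∉) (λ f → f k≢)
    where
    no-differ : ∀ k → k ∉ F → ¬ extend s x k ≢ extend t y k
    no-differ k k∉ k≢ with em {P = InRange (⟨ s ⟩ (S.length s x)) k} | em {P = ∃[ i ] at i ≡ k}
    ... | no ¬r | _              = k≢ (both-outside s t x y eq ¬r)
    ... | yes r | yes (i , refl) =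
          none (i , tame-upward s x (subst (_≤ at i) (sym (ν-zero true)) (proj₁ r)) t0 , k∉ , k≢)
    ... | yes r | no new         = k≢ (trans
          (new-plain s x {zeroᴶ} t0 (at-zero< s (new-not-old s new) (proj₁ r)) new r)
          (sym (new-plain t y {zeroᴶ} (sub zeroᴶ t0) (at-zero< s (new-not-old s new) (proj₁ r)) new
            (subst (λ l → InRange l k) eq r))))
  ...   | no ¬zero = fill-case (escape {z} (gap-descending cut) F)
    where
    cut : Cut T_I N at (tame s x)
    cut = tame-cut s x ¬zero

    z : ℕ → I
    z = gap (tame s x)

    z-range : ∀ n → InRange (⟨ s ⟩ (S.length s x)) (z n)
    z-range n = subst (_≤ z n) (ν-zero true) (proj₁ (gap-above cut {zeroᴶ} (λ t → ¬zero (⌊⌋⁻ t)) n)) ,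
                proj₁ (gap-below cut {s , S.length s x} (⌊⌋⁺ (tame-high s x)) n)

    -- Strong amalgamation puts the shared length into the base, as `Starred` requires.
    common-length : ∃[ l ] ι.fn s l ≡ S.length s x
    common-length with strong s≢t (S.length s x) (S.length t y) eq
    ... | l , p , _ = l , sym p

    z-fresh : ∀ n → extend s x (z n) ≡ fresh s
    z-fresh n = extend-starred s x (new-not-old s (gap-new s x ¬zero n)) (z-range n)
      (λ (c , j , near , p) → <-irrefl (<-trans p (gap-below cut {j} (⌊⌋⁺ (inj₁ (c , near))) n)))
      (common-length , ¬zero , n , refl)

    z-differ : ∀ n → extend s x (z n) ≢ extend t y (z n)
    z-differ n p with new-value t y (gap-new s x ¬zero n) (subst (λ l → InRange l (z n)) eq (z-range n))
    ... | plain q         = contradiction (trans (sym (z-fresh n)) (trans p q)) λ ()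
    ... | starred q _ _ _ = s≢t (cong side (trans (sym (z-fresh n)) (trans p q)))
      where
      side : Elem → Bool
      side (inj₁ _)       = s
      side (inj₂ (s′ , _)) = s′

    fill-case : ∃[ n ] (∀ m → n ℕ.≤ m → z m ∉ F) → HasMax (Differ (extend s x) (extend t y) F)
    fill-case (n , avoid) = finite-max em (Differ (extend s x) (extend t y) F) (applyUpTo z n) (z n)
        (avoid n ℕ.≤-refl , z-differ n) listed
      where
      gap-listed : ∀ {k} m → k ≡ z m → z n < k → k ∈ applyUpTo z n
      gap-listed m refl p with ℕ.<-cmp m n
      ... | tri< m<n _ _  = ∈-applyUpTo⁺ z m<n
      ... | tri≈ _ refl _ = contradiction p <-irrefl
      ... | tri> _ _ n<m  = contradiction (<-trans p (descending (gap-descending cut) n<m)) <-irrefl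

      -- Tame indices of `y` lie above its star, hence above `z n`, which exceeds every index that
      -- is not tame for `x`. With `sub` the tame sets coincide, so a star of `y` above `z n` is
      -- itself a term of `z`.
      same-tame : ¬ Tame t y zeroᴶ → ∀ m → z n < gap (tame t y) m → tame s x ≡ tame t y
      same-tame ¬zero′ m p = funext λ j → ⌊⌋-cong (sub j) λ ty → stable λ ¬tx → <-irrefl
        (<-trans p (<-trans (gap-below (tame-cut t y ¬zero′) {j} (⌊⌋⁺ ty) m)
                            (gap-above cut {j} (λ tx → ¬tx (⌊⌋⁻ tx)) n)))

      listed : ∀ k → z n < k → Differ (extend s x) (extend t y) F k → k ∈ applyUpTo z n
      listed k p (k∉ , k≢) with em {P = InRange (⟨ s ⟩ (S.length s x)) k} | em {P = ∃[ i ] at i ≡ k}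
      ... | no ¬r | _ = contradiction (both-outside s t x y eq ¬r) k≢
      ... | yes r | yes (i , refl) = contradiction
            (<-trans p (gap-above cut {i} (λ tx → none (i , ⌊⌋⁻ tx , k∉ , k≢)) n)) <-irrefl
      ... | yes r | no new with new-value s x new r | new-value t y new (subst (λ l → InRange l k) eq r)
      ...   | starred _ _ m q | _ = gap-listed m q p
      ...   | plain q | plain q′ = contradiction (trans q (sym q′)) k≢
      ...   | plain q | starred _ ¬zero′ m refl =
              gap-listed m (cong (λ U → gap U m) (sym (same-tame ¬zero′ m p))) p

  -- Upward closed sets in a linear order are comparable, so one tame set contains the other.
  maxDiff-arrays : ∀ s t x y → ⟨ s ⟩ (S.length s x) ≡ ⟨ t ⟩ (S.length t y) → MaxDiff (extend s x) (extend t y)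
  maxDiff-arrays s t x y eq with s Bool.≟ t | em {P = ∀ j → Tame s x j → Tame t y j}
  ... | yes refl | _       = maxDiff-same s x y (ν-injective s eq)
  ... | no s≢t   | yes sub = maxDiff-cross s≢t x y eq sub
  ... | no s≢t   | no ¬sub = maxDiff-sym (maxDiff-cross (s≢t ∘ sym) y x (sym eq) λ j ty → stable λ ¬tx →
          ¬sub λ j′ tx → tame-upward t y (proj₁ (≰⇒> em λ p → ¬tx (tame-upward s x p tx))) ty)

  -- The array sort of the amalgam

  abstract
    constant : I → I → Elem
    constant l k with em {P = InRange l k}
    ... | yes _ = elᴱ
    ... | no _  = ⊥ᴱ

    constant-in : ∀ {l k} → InRange l k → constant l k ≡ elᴱ
    constant-in {l} {k} r with em {P = InRange l k}
    ... | yes _ = refl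
    ... | no ¬r = contradiction r ¬r

    constant-out : ∀ {l k} → ¬ InRange l k → constant l k ≡ ⊥ᴱ
    constant-out {l} {k} ¬r with em {P = InRange l k}
    ... | yes r = contradiction r ¬r
    ... | no _  = refl

    -- Both side conditions are forced: with the length fixed, a write may neither create nor
    -- destroy defined values.
    update : (I → Elem) → I → I → Elem → I → Elem
    update f l i e k with em {P = i ≡ k × e ≢ ⊥ᴱ × InRange l i}
    ... | yes _ = e
    ... | no _  = f k

    update-same : ∀ f {l i e} → e ≢ ⊥ᴱ → InRange l i → update f l i e i ≡ e
    update-same f {l} {i} {e} e≢ r with em {P = i ≡ i × e ≢ ⊥ᴱ × InRange l i}
    ... | yes _ = refl
    ... | no ¬p = contradiction (refl , e≢ , r) ¬p

    update-unchanged : ∀ f {l i e k} → ¬ (i ≡ k × e ≢ ⊥ᴱ × InRange l i) → update f l i e k ≡ f k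
    update-unchanged f {l} {i} {e} {k} ¬p with em {P = i ≡ k × e ≢ ⊥ᴱ × InRange l i}
    ... | yes p = contradiction p ¬p
    ... | no _  = refl

  -- Constant arrays of new lengths are needed for Const and do no harm without it.
  Base : Set ℓ
  Base = (Σ[ s ∈ Bool ] S.Array s) ⊎ (Σ[ l ∈ I ] zeroᴵ ≤ l × New l)

  base-read : Base → I → Elem
  base-read (inj₁ (s , x)) = extend s x
  base-read (inj₂ (l , _)) = constant l

  base-length : Base → I
  base-length (inj₁ (s , x)) = ⟨ s ⟩ (S.length s x)
  base-length (inj₂ (l , _)) = l

  base-length-≥0 : ∀ b → zeroᴵ ≤ base-length b
  base-length-≥0 (inj₁ (s , x))     = subst (_≤ _) (ν-zero s) (Mono.≤⁺ s (S.length-≥0 s x))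
  base-length-≥0 (inj₂ (_ , p , _)) = p

  maxDiff-base : ∀ b b′ → base-length b ≡ base-length b′ → MaxDiff (base-read b) (base-read b′)
  maxDiff-base (inj₁ (s , x)) (inj₁ (t , y)) eq = maxDiff-arrays s t x y eq
  maxDiff-base (inj₁ (s , x)) (inj₂ (_ , _ , new)) eq = contradiction ((s , S.length s x) , eq) new
  maxDiff-base (inj₂ (_ , _ , new)) (inj₁ (t , y)) eq = contradiction ((t , S.length t y) , sym eq) new
  maxDiff-base (inj₂ (l , _)) (inj₂ (.l , _)) refl = maxDiff-refl (constant l)

  HasLength : (I → Elem) → I → Set ℓ
  HasLength f l = ∀ k → (InRange l k → f k ≢ ⊥ᴱ) × (¬ InRange l k → f k ≡ ⊥ᴱ)

  length-unique : ∀ {f l l′} → HasLength f l → HasLength f l′ → zeroᴵ ≤ l → zeroᴵ ≤ l′ → l ≡ l′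
  length-unique h h′ p p′ = ≤-antisym (bound h h′ p) (bound h′ h p′)
    where
    bound : ∀ {f l l′} → HasLength f l → HasLength f l′ → zeroᴵ ≤ l → l ≤ l′
    bound {l = l} h h′ p = proj₂ (stable λ ¬r → proj₁ (h l) (p , ≤-refl) (proj₂ (h′ l) ¬r))

  -- Closure under `write` forces all finite modifications in. Neither `b` nor `F` is determined by
  -- `f`, but the length is, by `length-unique`.
  IsArray : (I → Elem) → Set ℓ
  IsArray f = ∃[ b ] HasLength f (base-length b) × ∃[ F ] (∀ k → k ∉ F → f k ≡ base-read b k)

  Array : Set ℓ
  Array = Σ[ f ∈ (I → Elem) ] T ⌊ IsArray f ⌋

  array≡ : ∀ {x y : Array} → (∀ k → proj₁ x k ≡ proj₁ y k) → x ≡ y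
  array≡ {f , p} {g , q} eqs with funext eqs
  ... | refl = cong (f ,_) (T-irrelevant p q)

  isArray : (x : Array) → IsArray (proj₁ x)
  isArray (_ , p) = ⌊⌋⁻ p

  length : Array → I
  length x = base-length (proj₁ (isArray x))

  length-≥0 : ∀ x → zeroᴵ ≤ length x
  length-≥0 x = base-length-≥0 (proj₁ (isArray x))

  hasLength : ∀ x → HasLength (proj₁ x) (length x)
  hasLength x = proj₁ (proj₂ (isArray x))

  length≡ : ∀ x {l} → zeroᴵ ≤ l → HasLength (proj₁ x) l → length x ≡ l
  length≡ x p h = length-unique (hasLength x) h (length-≥0 x) p

  update-HasLength : ∀ {f l} i e → HasLength f l → HasLength (update f l i e) l
  update-HasLength {f} {l} i e h k with em {P = i ≡ k × e ≢ ⊥ᴱ × InRange l i}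
  ... | yes (refl , e≢ , r) = (λ _ eq → e≢ (trans (sym (update-same f e≢ r)) eq)) , λ ¬r → contradiction r ¬r
  ... | no ¬p = (λ r eq → proj₁ (h k) r (trans (sym (update-unchanged f ¬p)) eq)) ,
                λ ¬r → trans (update-unchanged f ¬p) (proj₂ (h k) ¬r)

  write : Array → I → Elem → Array
  write x i e = update (proj₁ x) (length x) i e , ⌊⌋⁺ (is (isArray x))
    where
    is : (p : IsArray (proj₁ x)) → IsArray (update (proj₁ x) (base-length (proj₁ p)) i e)
    is (b , h , F , f) = b , update-HasLength i e h , i ∷ F , λ k k∉ →
      trans (update-unchanged (proj₁ x) (λ (i≡k , _) → k∉ (here (sym i≡k)))) (f k (k∉ ∘ there))

  private
    longer : (x y : Array) → length x < length y → HasMax (Differ (proj₁ x) (proj₁ y) [])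
    longer x y p = length y ,
      ((λ ()) , λ eq → proj₁ (hasLength y _) (length-≥0 y , ≤-refl)
        (trans (sym eq) (proj₂ (hasLength x _) λ (_ , q) → <⇒≱ p q))) ,
      λ k q (_ , k≢) → k≢ (trans (proj₂ (hasLength x k) λ (_ , r) → <⇒≱ (<-trans p q) r)
                         (sym (proj₂ (hasLength y k) λ (_ , r) → <⇒≱ q r)))

  max-difference : (x y : Array) → x ≢ y → HasMax (Differ (proj₁ x) (proj₁ y) [])
  max-difference x y x≢y with ≤-or-> em (length x) (length y) | em {P = length x ≡ length y}
  ... | inj₁ p | no l≢ = longer x y (p , l≢)
  ... | inj₂ p | _     with longer y x p
  ...   | m , (m∉ , ≢m) , above = m , (m∉ , ≢m ∘ sym) , λ k q (k∉ , k≢) → above k q (k∉ , k≢ ∘ sym)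
  max-difference x y x≢y | inj₁ _ | yes eq with isArray x | isArray y
  ... | b , _ , F , f | b′ , _ , F′ , f′
    with ¬∀⇒∃ {P = λ k → proj₁ x k ≢ proj₁ y k} (λ all → x≢y (array≡ λ k → stable (all k)))
  ...   | k , k≢ = maxDiff-beyond (maxDiff-base b b′ eq) [] (F ++ F′) k ((λ ()) , k≢)
          λ k _ k∉ → f k (k∉ ∘ ∈-++⁺ˡ) , f′ k (k∉ ∘ ∈-++⁺ʳ F)

  abstract
    difference : Array → Array → I
    difference x y with em {P = x ≡ y}
    ... | yes _ = zeroᴵ
    ... | no x≢y = proj₁ (max-difference x y x≢y)

    difference-same : (x : Array) → difference x x ≡ zeroᴵ
    difference-same x with em {P = x ≡ x}
    ... | yes _ = refl
    ... | no x≢x = contradiction refl x≢x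

    difference-differs : (x y : Array) → x ≢ y → proj₁ x (difference x y) ≢ proj₁ y (difference x y)
    difference-differs x y x≢y with em {P = x ≡ y}
    ... | yes eq = contradiction eq x≢y
    ... | no x≢y with max-difference x y x≢y
    ...   | _ , (_ , ≢m) , _ = ≢m

    difference-max : (x y : Array) → ∀ {k} → difference x y < k → proj₁ x k ≡ proj₁ y k
    difference-max x y {k} p with em {P = x ≡ y}
    ... | yes refl = refl
    ... | no x≢y with max-difference x y x≢y
    ...   | _ , _ , above = stable λ k≢ → above k p ((λ ()) , k≢)

  difference-unique : (x y : Array) → ∀ {m} → proj₁ x m ≢ proj₁ y m → (∀ k → m < k → proj₁ x k ≡ proj₁ y k) →
                      difference x y ≡ m
  difference-unique x y {m} ≢m above = ≤-antisym
    (≮⇒≥ em λ p → difference-differs x y (λ { refl → ≢m refl }) (above _ p))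
    (≮⇒≥ em λ p → ≢m (difference-max x y p))

  -- Embedding the arrays of the two models

  extend-HasLength : ∀ s x → HasLength (extend s x) (⟨ s ⟩ (S.length s x))
  extend-HasLength s x k = extend-inside s x , extend-outside s x

  array : ∀ s → S.Array s → Array
  array s x = extend s x , ⌊⌋⁺ (inj₁ (s , x) , extend-HasLength s x , [] , λ _ _ → refl)

  length-array : ∀ s x → length (array s x) ≡ ⟨ s ⟩ (S.length s x)
  length-array s x = length≡ (array s x) (base-length-≥0 (inj₁ (s , x))) (extend-HasLength s x)

  array-injective : ∀ s {x y} → array s x ≡ array s y → x ≡ y
  array-injective s {x} {y} eq = array-ext em T_I L (M s) λ i → elem-injective s
    (trans (sym (extend-old s x i)) (trans (cong (λ z → proj₁ z (⟨ s ⟩ i)) eq) (extend-old s y i)))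

  extend-cofinite : ∀ s {x y k} F → S.length s x ≡ S.length s y →
                    (∀ i → ⟨ s ⟩ i ∉ F → S.read s x i ≡ S.read s y i) → ¬ Old s k → extend s x k ≡ extend s y k
  extend-cofinite s {x} {y} {k} F eq agree ¬old with em {P = InRange (⟨ s ⟩ (S.length s x)) k}
  ... | no ¬r = both-outside s s x y (cong ⟨ s ⟩ eq) ¬r
  ... | yes r = extend-agree s {j = zeroᴶ} (eq , F , λ i _ → agree i) ¬old (at-zero< s ¬old (proj₁ r))

  array-write : ∀ s x i e → array s (S.write s x i e) ≡ write (array s x) (⟨ s ⟩ i) (elem s e)
  array-write s x i e = array≡ pointwise
    where
    l≡ : length (array s x) ≡ ⟨ s ⟩ (S.length s x)
    l≡ = length-array s x

    pointwise : ∀ k → extend s (S.write s x i e) k ≡ update (extend s x) (length (array s x)) (⟨ s ⟩ i) (elem s e) k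
    pointwise k with em {P = Old s k}
    ... | no ¬old = trans
          (extend-cofinite s (⟨ s ⟩ i ∷ []) (S.length-write s x i e)
            (λ j j∉ → S.read-write-other s x e λ { refl → j∉ (here refl) }) ¬old)
          (sym (update-unchanged (extend s x) λ (eq , _) → ¬old (i , eq)))
    ... | yes (j , refl) with em {P = ⟨ s ⟩ i ≡ ⟨ s ⟩ j × elem s e ≢ ⊥ᴱ × InRange (length (array s x)) (⟨ s ⟩ i)}
    ...   | no ¬p = trans (extend-old s _ j) (trans (cong (elem s) unchanged)
              (trans (sym (extend-old s x j)) (sym (update-unchanged (extend s x) ¬p))))
      where
      out : ∀ {z} → S.length s z ≡ S.length s x → ¬ InRange (length (array s x)) (⟨ s ⟩ j) → S.read s z j ≡ S.bottom s
      out eq ¬r = read-out′ s (¬r ∘ subst (λ l → InRange l (⟨ s ⟩ j)) (trans (cong ⟨ s ⟩ eq) (sym l≡)))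

      unchanged : S.read s (S.write s x i e) j ≡ S.read s x j
      unchanged with em {P = i ≡ j} | em {P = e ≡ S.bottom s} | em {P = InRange (length (array s x)) (⟨ s ⟩ i)}
      ... | no i≢j | _ | _ = S.read-write-other s x e i≢j
      ... | yes _ | yes refl | _ = cong (λ z → S.read s z j) (S.write-bottom s x i)
      ... | yes refl | _ | no ¬r = trans (out (S.length-write s x i e) ¬r) (sym (out refl ¬r))
      ... | yes refl | no e≢ | yes r = contradiction (refl , e≢ ∘ elem-bottom⁻ s , r) ¬p
    ...   | yes (i≡j , e≢ , r) with ν-injective s i≡j
    ...     | refl = trans (extend-old s _ i) (trans (cong (elem s) (S.read-write-same s
                (λ eq → e≢ (trans (cong (elem s) eq) (elem-bottom s))) (proj₁ r′) (proj₂ r′)))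
              (sym (update-same (extend s x) e≢ r)))
      where
      r′ : S._≤_ s (S.zeroᴵ s) i × S._≤_ s i (S.length s x)
      r′ = range⁻ s (subst (λ l → InRange l (⟨ s ⟩ i)) l≡ r)

  array-diff : ∀ s x y → ⟨ s ⟩ (S.Diff s x y) ≡ difference (array s x) (array s y)
  array-diff s x y with em {P = x ≡ y}
  ... | yes refl = trans (cong ⟨ s ⟩ (S.Diff-same s x)) (trans (ν-zero s) (sym (difference-same (array s x))))
  ... | no x≢y = sym (difference-unique (array s x) (array s y)
        (λ eq → S.Diff-differs s x≢y (elem-injective s
          (trans (sym (extend-old s x _)) (trans eq (extend-old s y _)))))
        above)
    where
    d : S.I s
    d = S.Diff s x y

    agree : ∀ i → ⟨ s ⟩ d < ⟨ s ⟩ i → S.read s x i ≡ S.read s y i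
    agree i p = S.Diff-max s (Mono.<⁻ s p)

    -- If `k` were in range, the end of the longer array would lie beyond `d`; but only the longer
    -- array is defined there, against `agree`.
    outer : ∀ {x y : S.Array s} {k} → (∀ i → ⟨ s ⟩ d < ⟨ s ⟩ i → S.read s x i ≡ S.read s y i) →
            ⟨ s ⟩ d < k → ⟨ s ⟩ (S.length s x) < ⟨ s ⟩ (S.length s y) → ¬ InRange (⟨ s ⟩ (S.length s y)) k
    outer {x} {y} agree d<k p (_ , q) = S.read-≢⊥ s (S.length-≥0 s y) (S.≤-refl s)
      (trans (sym (agree (S.length s y) (<-≤-trans d<k q)))
             (read-out′ s λ (_ , r) → <⇒≱ p r))

    above : ∀ k → ⟨ s ⟩ d < k → extend s x k ≡ extend s y k
    above k p with em {P = Old s k}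
    ... | yes (i , refl) = trans (extend-old s x i) (trans (cong (elem s) (agree i p)) (sym (extend-old s y i)))
    ... | no ¬old with em {P = S.length s x ≡ S.length s y}
                     | ≤-or-> em (⟨ s ⟩ (S.length s x)) (⟨ s ⟩ (S.length s y))
    ...   | yes eq | _ = extend-agree s {j = s , d} (eq , [] , λ i q _ → agree i q) ¬old p
    ...   | no l≢ | inj₁ q = let q′ = (q , l≢ ∘ ν-injective s) in trans
            (extend-outside s x λ (a , r) → outer agree p q′ (a , ≤-trans r q))
            (sym (extend-outside s y (outer agree p q′)))
    ...   | no l≢ | inj₂ q = let agree′ = λ i r → sym (agree i r) in trans
            (extend-outside s x (outer agree′ p q))
            (sym (extend-outside s y λ (a , r) → outer agree′ p q (a , ≤-trans r (proj₁ q))))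

  -- Constant arrays

  -- Taking the equation as an argument keeps the construction uniform in the language.
  const : L ≡ cardc → ∀ s → S.I s → S.Array s
  const refl s i = Model.funI (M s) Const (i ∷ [])

  constᴬ : L ≡ cardc → A.I → A.Array
  constᴬ refl i = Model.funI A Const (i ∷ [])

  length-const : ∀ L≡ s i → S.length s (const L≡ s i) ≡ S.maxᴵ s i (S.zeroᴵ s)
  length-const refl s i = Model.satisfies (M s) len-Const i

  read-const : ∀ L≡ s i j → S._≤_ s (S.zeroᴵ s) j → S._≤_ s j (S.length s (const L≡ s i)) →
               S.read s (const L≡ s i) j ≡ Model.funI (M s) el []
  read-const refl s i j p q = Model.satisfies (M s) rd-Const i j (p , q)

  const-ι : ∀ L≡ s l → ι.fn s (constᴬ L≡ l) ≡ const L≡ s (ι.fn s l)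
  const-ι refl s l = ι.fun-homo s Const _

  ν-length-const : ∀ L≡ s i → ⟨ s ⟩ (S.length s (const L≡ s i)) ≡ maxᴵ (⟨ s ⟩ i) zeroᴵ
  ν-length-const L≡ s i = trans (cong ⟨ s ⟩ (length-const L≡ s i))
    (trans (ν.fun-homo s max _) (cong (maxᴵ (⟨ s ⟩ i)) (ν-zero s)))

  elem-const : ∀ L≡ s i {j} → InRange (⟨ s ⟩ (S.length s (const L≡ s i))) (⟨ s ⟩ j) →
               elem s (S.read s (const L≡ s i) j) ≡ elᴱ
  elem-const L≡ s i r with range⁻ s r
  ... | p , q = trans (cong (elem s) (read-const L≡ s i _ p q)) (elem-el s)

  extendᴬ-const : ∀ L≡ l {k} → InRange (νA (A.length (constᴬ L≡ l))) k → extendᴬ (constᴬ L≡ l) k ≡ elᴱ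
  extendᴬ-const L≡ l {k} r with em {P = ∃[ j ] at j ≡ k}
  ... | no new = extendᴬ-new _ new r
  ... | yes ((t , i) , refl) = trans (extendᴬ-at _ t i) (trans
        (cong (λ z → elem t (S.read t z i)) (const-ι L≡ t l))
        (elem-const L≡ t (ι.fn t l) (subst (λ z → InRange (⟨ t ⟩ (S.length t z)) (⟨ t ⟩ i)) (const-ι L≡ t l)
          (subst (λ z → InRange z (⟨ t ⟩ i)) (sym (length-ι t _)) r))))

  const-base : ∀ L≡ s i {l} → ι.fn s l ≡ S.length s (const L≡ s i) → ι.fn s (constᴬ L≡ l) ≡ const L≡ s i
  const-base L≡ s i {l} eq = trans (const-ι L≡ s l) (array-ext em T_I L (M s) same-read)
    where
    0≤ : S._≤_ s (S.zeroᴵ s) (ι.fn s l)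
    0≤ = subst (S._≤_ s (S.zeroᴵ s)) (sym eq) (S.length-≥0 s _)

    lengths : S.length s (const L≡ s (ι.fn s l)) ≡ S.length s (const L≡ s i)
    lengths = trans (length-const L≡ s _) (trans (S.max-≥ s 0≤) eq)

    same-read : ∀ j → S.read s (const L≡ s (ι.fn s l)) j ≡ S.read s (const L≡ s i) j
    same-read j with em {P = InRange (⟨ s ⟩ (S.length s (const L≡ s i))) (⟨ s ⟩ j)}
    ... | yes r = elem-injective s (trans
          (elem-const L≡ s _ (subst (λ m → InRange (⟨ s ⟩ m) (⟨ s ⟩ j)) (sym lengths) r))
          (sym (elem-const L≡ s i r)))
    ... | no ¬r = trans (read-out′ s (¬r ∘ subst (λ m → InRange (⟨ s ⟩ m) (⟨ s ⟩ j)) lengths))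
                    (sym (read-out′ s ¬r))

  -- If the length is in the base, so is the array, by `const-base`. Otherwise no base array is near
  -- it and stars are excluded, which leaves `elᴱ` at new indices.
  extend-const : ∀ L≡ s i k → extend s (const L≡ s i) k ≡ constant (⟨ s ⟩ (S.length s (const L≡ s i))) k
  extend-const L≡ s i k
    with em {P = InRange (⟨ s ⟩ (S.length s (const L≡ s i))) k} | em {P = Old s k}
       | em {P = ∃[ l ] ι.fn s l ≡ S.length s (const L≡ s i)}
  ... | no ¬r | _ | _ = trans (extend-outside s _ ¬r) (sym (constant-out ¬r))
  ... | yes r | yes (j , refl) | _ =
        trans (extend-old s _ j) (trans (elem-const L≡ s i r) (sym (constant-in r)))
  ... | yes r | no ¬old | yes (l , eq) = trans
        (cong (λ z → extend s z k) (sym (const-base L≡ s i eq)))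
        (trans (extend-ι s _ k) (trans (extendᴬ-const L≡ l (subst (λ m → InRange m k) lengths r)) (sym (constant-in r))))
    where
    lengths : ⟨ s ⟩ (S.length s (const L≡ s i)) ≡ νA (A.length (constᴬ L≡ l))
    lengths = trans (cong (⟨ s ⟩ ∘ S.length s) (sym (const-base L≡ s i eq))) (length-ι s _)
  ... | yes r | no ¬old | no ¬l = trans
        (extend-plain s _ ¬old r
          (λ (c , _ , n , _) → ¬l (A.length c , trans (ι.fun-homo s len _) (sym (proj₁ n))))
          (λ (l , _) → ¬l l))
        (sym (constant-in r))

  max-≥0 : ∀ i → zeroᴵ ≤ maxᴵ i zeroᴵ
  max-≥0 i with total i zeroᴵ
  ... | inj₁ p = subst (zeroᴵ ≤_) (sym (max-≤ p)) ≤-refl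
  ... | inj₂ p = subst (zeroᴵ ≤_) (sym (max-≥ p)) p

  constant-HasLength : ∀ l → HasLength (constant l) l
  constant-HasLength l k = (λ r eq → ⊥≢el (sym (trans (sym (constant-in r)) eq))) , constant-out

  constant-isArray : L ≡ cardc → ∀ {l} → zeroᴵ ≤ l → IsArray (constant l)
  constant-isArray L≡ {l} 0≤l with em {P = ∃[ j ] at j ≡ l}
  ... | no new = inj₂ (l , 0≤l , new) , constant-HasLength l , [] , λ _ _ → refl
  ... | yes ((s , i) , refl) = inj₁ (s , const L≡ s i) , subst (HasLength _) (sym lengths) (constant-HasLength _) ,
        [] , λ k _ → sym (trans (extend-const L≡ s i k) (cong (λ l → constant l k) lengths))
    where
    lengths : ⟨ s ⟩ (S.length s (const L≡ s i)) ≡ ⟨ s ⟩ i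
    lengths = trans (ν-length-const L≡ s i) (max-≥ 0≤l)

  constant-array : L ≡ cardc → I → Array
  constant-array L≡ i = constant (maxᴵ i zeroᴵ) , ⌊⌋⁺ (constant-isArray L≡ (max-≥0 i))

  length-constant-array : ∀ L≡ i → length (constant-array L≡ i) ≡ maxᴵ i zeroᴵ
  length-constant-array L≡ i = length≡ (constant-array L≡ i) (max-≥0 i) (constant-HasLength _)

  -- The amalgamated model and its embeddings

  Carrierᴹ : ArraySort → Set ℓ
  Carrierᴹ ARRAY = Array
  Carrierᴹ ELEM  = Elem
  Carrierᴹ INDEX = I

  structure : Structure (ArraySignature (IndexSignature (IndexTheory.extra T_I)) L) ℓ
  structure = record
    { Carrier = Carrierᴹ
    ; point   = λ { ARRAY → array true (Model.point (M true) ARRAY) ; ELEM → ⊥ᴱ ; INDEX → Model.point N tt }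
    ; funI    = funI
    ; relI    = λ r xs → Model.relI N r (map⁻ xs)
    }
    where
    open Signature (ArraySignature (IndexSignature (IndexTheory.extra T_I)) L)

    funI : (f : Fun) → All Carrierᴹ (dom f) → Carrierᴹ (cod f)
    funI (idx f) xs               = Model.funI N f (map⁻ xs)
    funI rd      (x ∷ i ∷ [])     = proj₁ x i
    funI wr      (x ∷ i ∷ e ∷ []) = write x i e
    funI diff    (x ∷ y ∷ [])     = difference x y
    funI len     (x ∷ [])         = length x
    funI bot     []               = ⊥ᴱ
    funI el      []               = elᴱ
    funI Const   (i ∷ [])         = constant-array refl i

  private
    map⁻-map⁺ : ∀ {ss : List ⊤} (xs : All (λ _ → I) ss) → map⁻ {P = Carrierᴹ} {f = λ _ → INDEX} (map⁺ xs) ≡ xs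
    map⁻-map⁺ []       = refl
    map⁻-map⁺ (x ∷ xs) = cong (x ∷_) (map⁻-map⁺ xs)

    map⁺-map⁻ : ∀ s {ss : List ⊤} (xs : All (Model.Carrier (M s)) (map (λ _ → INDEX) ss)) → map⁺ (map⁻ xs) ≡ xs
    map⁺-map⁻ s {[]}    []       = refl
    map⁺-map⁻ s {_ ∷ _} (x ∷ xs) = cong (x ∷_) (map⁺-map⁻ s xs)

    reduct≡ : Reduct.reduct structure ≡ Model.structure N
    reduct≡ = cong₂ (λ F R → record { Carrier = Model.Carrier N ; point = Model.point N ; funI = F ; relI = R })
      (funext λ f → funext λ xs → cong (Model.funI N f) (map⁻-map⁺ xs))
      (funext λ r → funext λ xs → cong (Model.relI N r) (map⁻-map⁺ xs))

  satisfies : ∀ a → Holds structure (Theory.axiom (ArrayTheory.arrayTheory T_I L) a) []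
  satisfies (index-axiom a) = Reduct.lift⁺ structure φ []
    (subst (λ 𝓢 → Holds 𝓢 φ []) (sym reduct≡) (Model.satisfies N a))
    where φ = Theory.axiom (IndexTheory.theory T_I) a
  satisfies len-wr y i e =
    length≡ (write y i e) (length-≥0 y) (update-HasLength i e (hasLength y))
  satisfies wr-bot y i = array≡ λ k → update-unchanged (proj₁ y) λ (_ , ≢⊥ , _) → ≢⊥ refl
  satisfies rd-wr-same y i e (≢⊥ , p , q) = update-same (proj₁ y) (lower ∘ ≢⊥) (p , q)
  satisfies rd-wr-other y i j e i≢j = update-unchanged (proj₁ y) λ (eq , _) → lower (i≢j eq)
  satisfies rd-defined y i =
    (λ ≢⊥ → stable λ ¬r → lower (≢⊥ (proj₂ (hasLength y i) ¬r))) ,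
    (λ r eq → lift (proj₁ (hasLength y i) r eq))
  satisfies len-nonneg y = length-≥0 y
  satisfies diff-same y = difference-same y
  satisfies diff-differs x y x≢y eq = lift (difference-differs x y (lower ∘ x≢y) eq)
  satisfies diff-max x y i (p , ≢) = difference-max x y (p , lower ∘ ≢)
  satisfies bot≠el eq = lift (⊥≢el eq)
  satisfies len-Const i = length-constant-array refl i
  satisfies rd-Const i j (p , q) = constant-in (p , subst (j ≤_) (length-constant-array refl i) q)

  amalgam : Model ℓ (ArrayTheory.arrayTheory T_I L)
  amalgam = record { structure = structure ; satisfies = satisfies }

  embed : ∀ s → M s ↪ amalgam
  embed s = record
    { fn        = fn
    ; injective = λ { {ARRAY} → array-injective s ; {ELEM} → elem-injective s ; {INDEX} → ν-injective s }
    ; fun-homo  = fun-homo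
    ; rel-homo  = λ r xs → subst₂ (λ ys zs → Model.relI (M s) r ys ⇔ Model.relI N r zs)
                    (map⁺-map⁻ s xs) (sym (map⁻-fn xs)) (ν.rel-homo s r (map⁻ xs))
    }
    where
    open Signature (ArraySignature (IndexSignature (IndexTheory.extra T_I)) L)

    fn : ∀ {σ} → Model.Carrier (M s) σ → Carrierᴹ σ
    fn {ARRAY} = array s
    fn {ELEM}  = elem s
    fn {INDEX} = ⟨ s ⟩

    map⁻-fn : ∀ {ss : List ⊤} (xs : All (Model.Carrier (M s)) (map (λ _ → INDEX) ss)) →
              map⁻ (All.map fn xs) ≡ All.map ⟨ s ⟩ (map⁻ xs)
    map⁻-fn {[]}    []       = refl
    map⁻-fn {_ ∷ _} (x ∷ xs) = cong (⟨ s ⟩ x ∷_) (map⁻-fn xs)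

    fun-homo : ∀ f xs → fn (Model.funI (M s) f xs) ≡ Structure.funI structure f (All.map fn xs)
    fun-homo (idx f) xs = trans (cong (λ ys → ⟨ s ⟩ (Model.funI (M s) (idx f) ys)) (sym (map⁺-map⁻ s xs)))
      (trans (ν.fun-homo s f (map⁻ xs)) (cong (Model.funI N f) (sym (map⁻-fn xs))))
    fun-homo rd    (x ∷ i ∷ [])     = sym (extend-old s x i)
    fun-homo wr    (x ∷ i ∷ e ∷ []) = array-write s x i e
    fun-homo diff  (x ∷ y ∷ [])     = array-diff s x y
    fun-homo len   (x ∷ [])         = sym (length-array s x)
    fun-homo bot   []               = elem-bottom s
    fun-homo el    []               = elem-el s
    fun-homo Const (i ∷ [])         = array≡ λ k → trans (extend-const refl s i k)
                                        (cong (λ l → constant l k) (ν-length-const refl s i))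

  embed-ι : ∀ s t {σ} (a : Model.Carrier A σ) →
            Embedding.fn (embed s) (ι.fn s a) ≡ Embedding.fn (embed t) (ι.fn t a)
  embed-ι s t {ARRAY} a = array≡ λ k → trans (extend-ι s a k) (sym (extend-ι t a k))
  embed-ι s t {ELEM}  a = trans (elem-ι s a) (sym (elem-ι t a))
  embed-ι s t {INDEX} a = commute s t a

module _ (em : ∀ {a} → ExcludedMiddle a) (funext : ∀ {a b} → Extensionality a b)
  {ℓ} (T_I : IndexTheory ℓ) (L : Language) where

  amalgamation : Amalgamation ℓ (ArrayTheory.arrayTheory T_I L)
  amalgamation M₁ M₂ A ι₁ ι₂ = amalgam , embed true , embed false , embed-ι true false
    where
    M : Bool → Model ℓ (ArrayTheory.arrayTheory T_I L)
    M true  = M₁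
    M false = M₂

    ι : ∀ s → A ↪ M s
    ι true  = ι₁
    ι false = ι₂

    open Amalgam em funext T_I L A M ι (index-amalgam em funext T_I _ _ _)

theorem4 : (∀ {a} → ExcludedMiddle a) → (∀ {a b} → Extensionality a b) →
    ∀ {ℓ : Level} (T_I : IndexTheory ℓ) →
    Amalgamation ℓ (CARD T_I) × Amalgamation ℓ (CARDC T_I)
theorem4 em funext T_I = amalgamation em funext T_I card , amalgamation em funext T_I cardc
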